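{- Let $p,q,n$ be integers with $p\ge 1$, $0\le q\le 5$ and $n\ge 2^{3p+2}p^2+p+1$, and let $x=6p+q$. Then $$h(n,3n-x)=\begin{cases}\sum_{i=0}^{p}\binom{n}{i} & \text{if } q=0 \text{ or } 1,\\[1mm] \sum_{i=0}^{p}\binom{n}{i}+\binom{n-2}{p-1} & \text{if } q=2,\\[1mm] \sum_{i=0}^{p}\binom{n}{i}+\binom{n-1}{p} & \text{if } q=3\text{ or }4,\\[1mm] \sum_{i=0}^{p}\binom{n}{i}+\binom{n-1}{p}+\binom{n-2}{p} & \text{if } q=5.\end{cases}$$
   Context: Let $[n]=\{1,\dots,n\}$ and let $2^{[n]}$ be the family of all subsets of $[n]$. For sets $A,B,C\subset[n]$ put $d(A,B,C)=|A\cap B|+|B\cap C|+|C\cap A|$. For a positive integer $\ell$, let $\mathbf{H}_\ell$ be the class of families $\mathcal{H}$ of subsets of $[n]$ such that $d(A,B,C)\ge \ell$ for all $A,B,C\in\mathcal{H}$ (no distinctness of $A,B,C$ is required in this definition). Define $h(n,\ell)=\max\{|\mathcal{F}| : \mathcal{F}\subset 2^{[n]},\ \mathcal{F}\in\mathbf{H}_\ell\}$. -}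

module Defs where

open import Data.Bool.Properties using () renaming (_≟_ to _≟ᵇ_)
open import Data.Fin.Subset using (Subset; inside; outside; _∩_; ∣_∣)
open import Data.List using (List; []; _∷_; _++_; map; filter; length; sum; upTo)
open import Data.List.Extrema.Nat using (argmax; argmax-all; f[xs]≤f[argmax])
open import Data.List.Membership.Propositional using (_∈_)
open import Data.List.Membership.Propositional.Properties using (∈-++⁺ˡ; ∈-++⁺ʳ; ∈-map⁺; ∈-map⁻; ∈-++⁻; ∈-filter⁺; ∈-filter⁻)
open import Data.List.Membership.Propositional.Properties.WithK using (unique∧set⇒bag)
open import Data.List.Membership.DecPropositional using () renaming (_∈?_ to mem?)
open import Data.List.Relation.Binary.BagAndSetEquality using (∼bag⇒↭)
open import Data.List.Relation.Binary.Permutation.Propositional.Properties using (↭-length)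
open import Data.List.Relation.Unary.All as All using (All; []; _∷_; all?)
open import Data.List.Relation.Unary.All.Properties using (anti-mono)
open import Data.List.Relation.Unary.AllPairs using ([]; _∷_)
open import Data.List.Relation.Unary.Any using (here; there)
open import Data.List.Relation.Unary.Unique.Propositional using (Unique)
open import Data.List.Relation.Unary.Unique.Propositional.Properties using (map⁺; ++⁺; filter⁺)
open import Data.Nat using (ℕ; zero; suc; _+_; _≤_; _≤?_)
open import Data.Nat.Combinatorics using (_C_)
open import Data.Product using (∃-syntax; _×_; _,_; proj₁; proj₂)
open import Data.Sum using (inj₁; inj₂)
open import Data.Vec using ([]; _∷_)
open import Data.Vec.Properties using (≡-dec; ∷-injectiveʳ)
open import Function using (mk⇔)
open import Relation.Binary.PropositionalEquality using (_≡_; refl; sym; subst)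
open import Relation.Nullary using (Dec; yes; no)
open import Relation.Nullary.Decidable using (map′)

d : ∀ {n} → Subset n → Subset n → Subset n → ℕ
d A B C = ∣ A ∩ B ∣ + ∣ B ∩ C ∣ + ∣ C ∩ A ∣

-- A family ℱ ⊆ 2^[n] is a duplicate-free list of subsets (`Unique ℱ`), so that
-- |ℱ| is its length.  A, B, C need not be distinct in this condition.
𝐇 : ∀ {n} → ℕ → List (Subset n) → Set
𝐇 ℓ ℱ = ∀ {A B C} → A ∈ ℱ → B ∈ ℱ → C ∈ ℱ → ℓ ≤ d A B C

𝐇? : ∀ {n} ℓ (ℱ : List (Subset n)) → Dec (𝐇 ℓ ℱ)
𝐇? ℓ ℱ = map′
  (λ a A∈ B∈ C∈ → All.lookup (All.lookup (All.lookup a A∈) B∈) C∈)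
  (λ h → All.tabulate λ A∈ → All.tabulate λ B∈ → All.tabulate λ C∈ → h A∈ B∈ C∈)
  (all? (λ A → all? (λ B → all? (λ C → ℓ ≤? d A B C) ℱ) ℱ) ℱ)

-- 2^[n]
subsets : ∀ n → List (Subset n)
subsets zero    = [] ∷ []
subsets (suc n) = map (inside ∷_) (subsets n) ++ map (outside ∷_) (subsets n)

sublists : ∀ {A : Set} → List A → List (List A)
sublists []       = [] ∷ []
sublists (x ∷ xs) = map (x ∷_) (sublists xs) ++ sublists xs

-- The maximum over the finitely many families ℱ ⊆ 2^[n]; the default [] of
-- `argmax` is harmless since the empty family satisfies 𝐇 ℓ vacuously.
h : ℕ → ℕ → ℕ
h n ℓ = length (argmax length [] (filter (𝐇? ℓ) (sublists (subsets n))))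

-- ∑_{i=0}^{p} binom(n,i); `upTo (suc p)` lists 0, …, p.
∑C : ℕ → ℕ → ℕ
∑C n p = sum (map (n C_) (upTo (suc p)))

-- The lemmas below show that h n ℓ is max { |ℱ| : ℱ ⊆ 2^[n], ℱ ∈ 𝐇 ℓ }.

∈-subsets : ∀ {n} (A : Subset n) → A ∈ subsets n
∈-subsets []            = here refl
∈-subsets (inside ∷ A)  = ∈-++⁺ˡ (∈-map⁺ (inside ∷_) (∈-subsets A))
∈-subsets (outside ∷ A) =
  ∈-++⁺ʳ (map (inside ∷_) (subsets _)) (∈-map⁺ (outside ∷_) (∈-subsets A))

subsets-unique : ∀ n → Unique (subsets n)
subsets-unique zero    = [] ∷ []
subsets-unique (suc n) =
  ++⁺ (map⁺ ∷-injectiveʳ (subsets-unique n)) (map⁺ ∷-injectiveʳ (subsets-unique n)) disjoint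
  where
  disjoint : ∀ {A} → A ∈ map (inside ∷_) (subsets n) × A ∈ map (outside ∷_) (subsets n) → _
  disjoint (p , q) with ∈-map⁻ (inside ∷_) p | ∈-map⁻ (outside ∷_) q
  ... | _ , _ , refl | _ , _ , ()

∈-sublists⇒⊆ : ∀ {A : Set} {xs ys : List A} → ys ∈ sublists xs → ∀ {x} → x ∈ ys → x ∈ xs
∈-sublists⇒⊆ {xs = []}     (here refl) ()
∈-sublists⇒⊆ {xs = x ∷ xs} ys∈ y∈ with ∈-++⁻ (map (x ∷_) (sublists xs)) ys∈
... | inj₂ r = there (∈-sublists⇒⊆ r y∈)
... | inj₁ r with ∈-map⁻ (x ∷_) r
∈-sublists⇒⊆ _ (here refl) | inj₁ _ | _ , _ , refl = here refl
∈-sublists⇒⊆ _ (there y∈)  | inj₁ _ | _ , s , refl = there (∈-sublists⇒⊆ s y∈)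

sublists-unique : ∀ {A : Set} {xs ys : List A} → Unique xs → ys ∈ sublists xs → Unique ys
sublists-unique {xs = []}     _        (here refl) = []
sublists-unique {xs = x ∷ xs} (x∉ ∷ u) ys∈ with ∈-++⁻ (map (x ∷_) (sublists xs)) ys∈
... | inj₂ r = sublists-unique u r
... | inj₁ r with ∈-map⁻ (x ∷_) r
... | _ , s , refl = anti-mono (∈-sublists⇒⊆ s) x∉ ∷ sublists-unique u s

filter∈sublists : ∀ {A : Set} {P : A → Set} (P? : ∀ x → Dec (P x)) xs →
                  filter P? xs ∈ sublists xs
filter∈sublists P? []       = here refl
filter∈sublists P? (x ∷ xs) with P? x
... | yes _ = ∈-++⁺ˡ (∈-map⁺ (x ∷_) (filter∈sublists P? xs))
... | no  _ = ∈-++⁺ʳ (map (x ∷_) (sublists xs)) (filter∈sublists P? xs)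

h-attained : ∀ n ℓ → ∃[ ℱ ] Unique ℱ × 𝐇 {n} ℓ ℱ × length ℱ ≡ h n ℓ
h-attained n ℓ = _ , proj₁ good , proj₂ good , refl
  where
  Good : List (Subset n) → Set
  Good ℱ = Unique ℱ × 𝐇 ℓ ℱ
  good : Good (argmax length [] (filter (𝐇? ℓ) (sublists (subsets n))))
  good = argmax-all length {P = Good} ([] , λ ())
    (All.tabulate λ ℱ∈ → let s , hℱ = ∈-filter⁻ (𝐇? ℓ) {xs = sublists (subsets n)} ℱ∈
                         in sublists-unique (subsets-unique n) s , hℱ)

h-upper : ∀ n ℓ (ℱ : List (Subset n)) → Unique ℱ → 𝐇 ℓ ℱ → length ℱ ≤ h n ℓ
h-upper n ℓ ℱ u hℱ = subst (_≤ h n ℓ) (sym (↭-length (∼bag⇒↭ (unique∧set⇒bag u u′ (mk⇔ to from)))))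
  (All.lookup (f[xs]≤f[argmax] {f = length} [] (filter (𝐇? ℓ) (sublists (subsets n))))
    (∈-filter⁺ (𝐇? ℓ) (filter∈sublists ∈ℱ? (subsets n))
      (λ A∈ B∈ C∈ → hℱ (from A∈) (from B∈) (from C∈))))
  where
  ∈ℱ? : ∀ A → Dec (A ∈ ℱ)
  ∈ℱ? A = mem? (≡-dec _≟ᵇ_) A ℱ
  𝒢 : List (Subset n)
  𝒢 = filter ∈ℱ? (subsets n)
  u′ : Unique 𝒢
  u′ = filter⁺ ∈ℱ? (subsets-unique n)
  to : ∀ {A} → A ∈ ℱ → A ∈ 𝒢
  to {A} A∈ = ∈-filter⁺ ∈ℱ? (∈-subsets A) A∈
  from : ∀ {A} → A ∈ 𝒢 → A ∈ ℱ
  from A∈ = proj₂ (∈-filter⁻ ∈ℱ? {xs = subsets n} A∈)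

{-# OPTIONS --safe #-}
module Submission where

-- Passing to complements turns d(A, B, C) ≥ 3n − x into
-- |A ∪ B| + |B ∪ C| + |C ∪ A| ≤ x, a condition inherited by subsets, so the family may
-- be taken to be closed downwards.  If it has more than C(n − 2, p) members, then every
-- set U of at most 3p + 2 elements is avoided by some p-set of the family, since otherwise
-- all members have fewer than p elements outside U.  Adding such p-sets to one or two
-- given members bounds the sizes of members by p + ⌊q/2⌋ and forces the (p + 1)-sets to
-- be 2-intersecting (q = 2), essentially intersecting (q = 3, 4), or free of three
-- pairwise disjoint sets (q = 5); Erdős–Ko–Rado type arguments for large n then give
-- the bounds.  For q ≥ 4 a member A of size p + 2 is possible, but then almost all
-- other members are p-sets or, for q = 5, form an intersecting family.

open import Defs
open import Data.Bool using (true; false; if_then_else_)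
open import Data.Bool.Properties using () renaming (_≟_ to _≟ᵇ_)
open import Data.Empty using (⊥-elim)
open import Data.Fin using (Fin; zero; suc)
import Data.Fin.Properties as Fin
open import Data.Fin.Subset
open import Data.Fin.Subset.Properties
open import Data.List using (List; []; _∷_; _++_; length; filter; map; upTo)
open import Data.List.Membership.DecPropositional using () renaming (_∈?_ to mem?)
open import Data.List.Membership.Propositional using (find; lose) renaming (_∈_ to _∈ₗ_)
open import Data.List.Membership.Propositional.Properties using (∈-map⁻; ∈-filter⁺; ∈-filter⁻)
open import Data.List.Membership.Propositional.Properties.WithK using (unique∧set⇒bag)
open import Data.List.Properties using (length-++; length-map; filter-++; map-++; upTo-∷ʳ)
open import Data.List.Relation.Binary.BagAndSetEquality using (∼bag⇒↭)
open import Data.List.Relation.Binary.Permutation.Propositional.Properties using (↭-length)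
open import Data.List.Relation.Unary.Any as Any using (Any)
open import Data.List.Relation.Unary.Unique.Propositional using (Unique)
import Data.List.Relation.Unary.Unique.Propositional.Properties as Unique
open import Data.Nat
open import Data.Nat.Combinatorics using (_C_; nCk+nC[k+1]≡[n+1]C[k+1]; nCn≡1; nC1≡n; nCk≡nC[n∸k])
open import Data.Nat.ListAction using (sum)
open import Data.Nat.ListAction.Properties using (sum-++)
open import Data.Nat.Properties
open import Data.Nat.Tactic.RingSolver using (solve-∀)
open import Data.Product using (_×_; _,_; proj₁; proj₂; ∃-syntax)
open import Data.Sum using (_⊎_; inj₁; inj₂)
open import Data.Vec using ([]; _∷_; here; there)
open import Data.Vec.Properties using (≡-dec)
open import Function using (_∘_; id; case_of_; mk⇔)
open import Level using (0ℓ)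
open import Relation.Binary.PropositionalEquality
open import Relation.Nullary using (Dec; yes; no; does; ¬_; contradiction; ¬?; _×-dec_; _⊎-dec_)
open import Relation.Nullary.Decidable using (decidable-stable; from-yes)
open import Relation.Unary using (Pred; Decidable)

-- Binomial coefficients

-- The sets with at most p elements use only 6p of the allowed 6p + q, so q is the slack that larger
-- members may consume: a pair consumes |A ∪ B| - 2p, and the three pairs of a triple together at
-- most q. Large n is needed because exceptional families are concentrated: all members have fewer
-- than p elements outside a bounded set U, which leaves at most 2^|U| ∑_{i<p} C(n - |U|, i) of
-- them. The hypothesis on n makes this at most C(n - 2, p) whenever 2 ≤ |U| ≤ 3p + 2. The exponent
-- 3p + 2 covers every U that occurs: a (p + 2)-set and a disjoint (p + 1)-set span 2p + 3 elements,
-- at most 3p + 2 as p ≥ 1, and three pairwise intersecting (p + 1)-sets span at most 3p + 1. For q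
-- ≥ 3 an error of C(n - 2, p) fits into the claimed excess over ∑_{i≤p} C(n, i). For q = 2 that
-- excess is only C(n - 2, p - 1), so there the (p + 1)-sets are counted by concentration with p - 1
-- in place of p.

nC0≡1 : ∀ n → n C 0 ≡ 1
nC0≡1 n = trans (nCk≡nC[n∸k] {k = 0} {n = n} z≤n) (nCn≡1 n)

-- The absorption identity (k + 1) C(m, k + 1) = (m - k) C(m, k), kept free of truncated
-- subtraction; it supplies the ratio of consecutive binomial coefficients.
C-absorb : ∀ m k → suc k * (m C suc k) + k * (m C k) ≡ m * (m C k)
C-absorb zero    zero    = refl
C-absorb zero    (suc k) = cong₂ _+_ (*-zeroʳ (suc (suc k))) (*-zeroʳ (suc k))
C-absorb (suc m) zero    rewrite nC1≡n (suc m) | nC0≡1 (suc m) = identity m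
  where
  identity : ∀ m → 1 * suc m + 0 ≡ suc m * 1
  identity = solve-∀
C-absorb (suc m) (suc k)
  rewrite sym (nCk+nC[k+1]≡[n+1]C[k+1] m (suc k)) | sym (nCk+nC[k+1]≡[n+1]C[k+1] m k) = begin
    suc (suc k) * (y + z) + suc k * (x + y)                             ≡⟨ regroup k x y z ⟩
    (suc (suc k) * z + suc k * y) + (suc k * y + k * x) + (x + y)       ≡⟨ cong₂ (λ a b → a + b + (x + y)) (C-absorb m (suc k)) (C-absorb m k) ⟩
    m * y + m * x + (x + y)                                             ≡⟨ collect m x y ⟩
    suc m * (x + y)                                                     ∎
  where
  open ≡-Reasoning
  x = m C k
  y = m C suc k
  z = m C suc (suc k)
  regroup : ∀ k x y z → suc (suc k) * (y + z) + suc k * (x + y) ≡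
                        (suc (suc k) * z + suc k * y) + (suc k * y + k * x) + (x + y)
  regroup = solve-∀
  collect : ∀ m x y → m * y + m * x + (x + y) ≡ suc m * (x + y)
  collect = solve-∀

C-monoˡ : ∀ m k → m C k ≤ suc m C k
C-monoˡ m zero    = ≤-reflexive (trans (nC0≡1 m) (sym (nC0≡1 (suc m))))
C-monoˡ m (suc k) = subst (m C suc k ≤_) (nCk+nC[k+1]≡[n+1]C[k+1] m k) (m≤n+m _ _)

∑C< : ℕ → ℕ → ℕ
∑C< m zero    = 0
∑C< m (suc k) = ∑C< m k + m C k

∑C≡∑C< : ∀ n p → ∑C n p ≡ ∑C< n (suc p)
∑C≡∑C< n p = go (suc p)
  where
  go : ∀ k → sum (map (n C_) (upTo k)) ≡ ∑C< n k
  go zero    = refl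
  go (suc k) = begin
    sum (map (n C_) (upTo (suc k)))                  ≡⟨ cong (sum ∘ map (n C_)) (upTo-∷ʳ k) ⟨
    sum (map (n C_) (upTo k ++ k ∷ []))              ≡⟨ cong sum (map-++ (n C_) (upTo k) (k ∷ [])) ⟩
    sum (map (n C_) (upTo k) ++ n C k ∷ [])          ≡⟨ sum-++ (map (n C_) (upTo k)) (n C k ∷ []) ⟩
    sum (map (n C_) (upTo k)) + (n C k + 0)          ≡⟨ cong₂ _+_ (go k) (+-identityʳ (n C k)) ⟩
    ∑C< n k + n C k                                  ∎
    where open ≡-Reasoning

∑C<-0 : ∀ k → ∑C< 0 (suc k) ≡ 1
∑C<-0 zero    = refl
∑C<-0 (suc k) = trans (+-identityʳ _) (∑C<-0 k)

∑C<-pascal : ∀ m k → ∑C< (suc m) (suc k) ≡ ∑C< m k + ∑C< m (suc k)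
∑C<-pascal m zero    = trans (nC0≡1 (suc m)) (sym (nC0≡1 m))
∑C<-pascal m (suc k)
  rewrite ∑C<-pascal m k | sym (nCk+nC[k+1]≡[n+1]C[k+1] m k) = swap (∑C< m k) (m C k) (m C suc k)
  where
  swap : ∀ a x y → a + (a + x) + (x + y) ≡ a + x + (a + x + y)
  swap = solve-∀

∑C<-monoˡ : ∀ {m m′} k → m ≤ m′ → ∑C< m k ≤ ∑C< m′ k
∑C<-monoˡ {m} k m≤m′ = go (≤⇒≤′ m≤m′)
  where
  step : ∀ m k → ∑C< m k ≤ ∑C< (suc m) k
  step m zero    = z≤n
  step m (suc k) = +-mono-≤ (step m k) (C-monoˡ m k)
  go : ∀ {m′} → m ≤′ m′ → ∑C< m k ≤ ∑C< m′ k
  go ≤′-refl       = ≤-refl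
  go (≤′-step m≤′) = ≤-trans (go m≤′) (step _ k)

-- Each term of the sum is at most 1/(c k) of the next one.
∑C<-small : ∀ c m k → 1 ≤ c → c * (k * k) + k ≤ suc m → c * ∑C< m k ≤ m C k
∑C<-small c m zero    1≤c _ = subst (_≤ m C 0) (sym (*-zeroʳ c)) z≤n
∑C<-small c m (suc k) 1≤c c≤ = *-cancelˡ-≤ (suc k) (begin
  suc k * (c * (∑C< m k + m C k))   ≤⟨ *-monoʳ-≤ (suc k) (sum≤ k (∑C<-small c m k 1≤c) c≤) ⟩
  suc k * (c * (suc k * (m C k)))     ≤⟨ growth ⟩
  suc k * (m C suc k)               ∎)
  where
  open ≤-Reasoning
  bound : c * (suc k * suc k) + k ≤ m
  bound = s≤s⁻¹ (subst (_≤ suc m) (+-suc _ k) c≤)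
  -- `C-absorb` turns the right side into (m - k) C(m, k), and the hypothesis leaves m - k ≥ c (k +
  -- 1)².
  growth : suc k * (c * (suc k * (m C k))) ≤ suc k * (m C suc k)
  growth = +-cancelʳ-≤ (k * (m C k)) _ _ (begin
    suc k * (c * (suc k * (m C k))) + k * (m C k)  ≡⟨ factor c k (m C k) ⟩
    (c * (suc k * suc k) + k) * (m C k)          ≤⟨ *-monoˡ-≤ (m C k) bound ⟩
    m * (m C k)                                  ≡⟨ C-absorb m k ⟨
    suc k * (m C suc k) + k * (m C k)            ∎)
    where
    factor : ∀ c k x → suc k * (c * (suc k * x)) + k * x ≡ (c * (suc k * suc k) + k) * x
    factor = solve-∀
  -- The induction hypothesis bounds all earlier terms together by C(m, k), so two copies of C(m, k)
  -- suffice; k + 1 copies are available, which is enough unless k = 0, where there are no earlier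
  -- terms.
  sum≤ : ∀ k → (c * (k * k) + k ≤ suc m → c * ∑C< m k ≤ m C k) →
         c * (suc k * suc k) + suc k ≤ suc m → c * (∑C< m k + m C k) ≤ c * (suc k * (m C k))
  sum≤ zero    _  _  = *-monoʳ-≤ c (≤-reflexive (sym (+-identityʳ (m C 0))))
  sum≤ (suc j) ih c≤ = begin
    c * (∑C< m (suc j) + x)      ≡⟨ *-distribˡ-+ c (∑C< m (suc j)) x ⟩
    c * ∑C< m (suc j) + c * x    ≤⟨ +-monoˡ-≤ (c * x) (ih smaller) ⟩
    x + c * x                    ≤⟨ +-monoˡ-≤ (c * x) (m≤n*m x c {{>-nonZero 1≤c}}) ⟩
    c * x + c * x                ≤⟨ m≤m+n _ (c * (j * x)) ⟩
    c * x + c * x + c * (j * x)  ≡⟨ gather c j x ⟩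
    c * (suc (suc j) * x)        ∎
    where
    x = m C suc j
    gather : ∀ c j x → c * x + c * x + c * (j * x) ≡ c * (suc (suc j) * x)
    gather = solve-∀
    smaller : c * (suc j * suc j) + suc j ≤ suc m
    smaller = ≤-trans (+-mono-≤ (*-monoʳ-≤ c (*-mono-≤ (n≤1+n (suc j)) (n≤1+n (suc j)))) (n≤1+n (suc j))) c≤

-- Cardinalities of sets

∣∪∣+∣∩∣ : ∀ {n} (A B : Subset n) → ∣ A ∪ B ∣ + ∣ A ∩ B ∣ ≡ ∣ A ∣ + ∣ B ∣
∣∪∣+∣∩∣ []            []            = refl
∣∪∣+∣∩∣ (inside  ∷ A) (inside  ∷ B) rewrite +-suc ∣ A ∪ B ∣ ∣ A ∩ B ∣ | +-suc ∣ A ∣ ∣ B ∣ = cong (2 +_) (∣∪∣+∣∩∣ A B)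
∣∪∣+∣∩∣ (inside  ∷ A) (outside ∷ B) = cong suc (∣∪∣+∣∩∣ A B)
∣∪∣+∣∩∣ (outside ∷ A) (inside  ∷ B) rewrite +-suc ∣ A ∣ ∣ B ∣ = cong suc (∣∪∣+∣∩∣ A B)
∣∪∣+∣∩∣ (outside ∷ A) (outside ∷ B) = ∣∪∣+∣∩∣ A B

∣∪∣≡ : ∀ {n} (A B : Subset n) → ∣ A ∪ B ∣ ≡ ∣ A ∣ + ∣ B ─ A ∣
∣∪∣≡ []            []            = refl
∣∪∣≡ (inside  ∷ A) (_       ∷ B) = cong suc (∣∪∣≡ A B)
∣∪∣≡ (outside ∷ A) (inside  ∷ B) = trans (cong suc (∣∪∣≡ A B)) (sym (+-suc _ _))
∣∪∣≡ (outside ∷ A) (outside ∷ B) = ∣∪∣≡ A B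

∣─∣+∣∩∣ : ∀ {n} (A B : Subset n) → ∣ A ─ B ∣ + ∣ A ∩ B ∣ ≡ ∣ A ∣
∣─∣+∣∩∣ []            []            = refl
∣─∣+∣∩∣ (inside  ∷ A) (inside  ∷ B) = trans (+-suc _ _) (cong suc (∣─∣+∣∩∣ A B))
∣─∣+∣∩∣ (inside  ∷ A) (outside ∷ B) = cong suc (∣─∣+∣∩∣ A B)
∣─∣+∣∩∣ (outside ∷ A) (inside  ∷ B) = ∣─∣+∣∩∣ A B
∣─∣+∣∩∣ (outside ∷ A) (outside ∷ B) = ∣─∣+∣∩∣ A B

∣∪∣≤ : ∀ {n} (A B : Subset n) → ∣ A ∪ B ∣ ≤ ∣ A ∣ + ∣ B ∣
∣∪∣≤ A B = ≤-trans (m≤m+n _ _) (≤-reflexive (∣∪∣+∣∩∣ A B))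

nonempty⇒0< : ∀ {n} {A : Subset n} → Nonempty A → 0 < ∣ A ∣
nonempty⇒0< {A = A} (x , x∈A) = subst (_≤ ∣ A ∣) (∣⁅x⁆∣≡1 x) (p⊆q⇒∣p∣≤∣q∣ λ y∈ → subst (_∈ A) (sym (x∈⁅y⁆⇒x≡y x y∈)) x∈A)

empty⇒∣∣≡0 : ∀ {n} {A : Subset n} → Empty A → ∣ A ∣ ≡ 0
empty⇒∣∣≡0 {n} A∅ = trans (cong ∣_∣ (Empty-unique A∅)) (∣⊥∣≡0 n)

choose : ∀ {n} k (A : Subset n) → k ≤ ∣ A ∣ → ∃[ B ] B ⊆ A × ∣ B ∣ ≡ k
choose {n} zero    A             _  = ⊥ , ⊥⊆ , ∣⊥∣≡0 n
choose     (suc k) (inside  ∷ A) k≤ = let B , B⊆A , ∣B∣≡k = choose k A (s≤s⁻¹ k≤) in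
  inside ∷ B , s⊆s B⊆A , cong suc ∣B∣≡k
choose     (suc k) (outside ∷ A) k≤ = let B , B⊆A , ∣B∣≡k = choose (suc k) A k≤ in
  outside ∷ B , s⊆s B⊆A , ∣B∣≡k

∈─⇒∉ : ∀ {n} {x} (A B : Subset n) → x ∈ A ─ B → x ∉ B
∈─⇒∉ (inside ∷ A) (outside ∷ B) here ()
∈─⇒∉ (_ ∷ A) (_ ∷ B) (there x∈) (there x∈B) = ∈─⇒∉ A B x∈ x∈B

disjoint-∣∪∣ : ∀ {n} (A B : Subset n) → Empty (A ∩ B) → ∣ A ∪ B ∣ ≡ ∣ A ∣ + ∣ B ∣
disjoint-∣∪∣ A B A∩B∅ = trans (sym (+-identityʳ _)) (trans (cong (∣ A ∪ B ∣ +_) (sym (empty⇒∣∣≡0 A∩B∅))) (∣∪∣+∣∩∣ A B))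

-- Counting the subsets of [n] with a decidable property

# : ∀ {n} {P : Pred (Subset n) 0ℓ} → Decidable P → ℕ
# {zero}  P? = if does (P? []) then 1 else 0
# {suc n} P? = # (λ D → P? (inside ∷ D)) + # (λ D → P? (outside ∷ D))

#-subadditive : ∀ {n} {P Q R : Pred (Subset n) 0ℓ} (P? : Decidable P) (Q? : Decidable Q) (R? : Decidable R) →
     (∀ D → P D → Q D ⊎ R D) → # P? ≤ # Q? + # R?
#-subadditive {zero} P? Q? R? P⇒ with P? [] | Q? [] | R? []
... | no  _ | _      | _      = z≤n
... | yes _ | yes _  | _      = s≤s z≤n
... | yes _ | no  _  | yes _  = ≤-refl
... | yes p | no  ¬q | no  ¬r with P⇒ [] p
... | inj₁ q = contradiction q ¬q
... | inj₂ r = contradiction r ¬r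
#-subadditive {suc n} P? Q? R? P⇒ = subst (# P? ≤_)
  (swap (# λ D → Q? (inside ∷ D)) (# λ D → R? (inside ∷ D)) (# λ D → Q? (outside ∷ D)) (# λ D → R? (outside ∷ D)))
  (+-mono-≤ (#-subadditive _ _ _ λ D → P⇒ (inside ∷ D)) (#-subadditive _ _ _ λ D → P⇒ (outside ∷ D)))
  where
  swap : ∀ a b c e → (a + b) + (c + e) ≡ (a + c) + (b + e)
  swap = solve-∀

#-superadditive : ∀ {n} {P Q R : Pred (Subset n) 0ℓ} (P? : Decidable P) (Q? : Decidable Q) (R? : Decidable R) →
     (∀ D → Q D → P D) → (∀ D → R D → P D) → (∀ D → Q D → ¬ R D) → # Q? + # R? ≤ # P?
#-superadditive {zero} P? Q? R? Q⇒ R⇒ Q∩R with P? [] | Q? [] | R? []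
... | no ¬p | yes q  | _      = contradiction (Q⇒ [] q) ¬p
... | no ¬p | no  _  | yes r  = contradiction (R⇒ [] r) ¬p
... | no  _ | no  _  | no  _  = z≤n
... | yes _ | yes q  | yes r  = contradiction r (Q∩R [] q)
... | yes _ | yes _  | no  _  = ≤-refl
... | yes _ | no  _  | yes _  = ≤-refl
... | yes _ | no  _  | no  _  = z≤n
#-superadditive {suc n} P? Q? R? Q⇒ R⇒ Q∩R = subst (_≤ # P?)
  (swap (# λ D → Q? (inside ∷ D)) (# λ D → R? (inside ∷ D)) (# λ D → Q? (outside ∷ D)) (# λ D → R? (outside ∷ D)))
  (+-mono-≤ (#-superadditive _ _ _ (λ D → Q⇒ (inside ∷ D)) (λ D → R⇒ (inside ∷ D)) (λ D → Q∩R (inside ∷ D)))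
            (#-superadditive _ _ _ (λ D → Q⇒ (outside ∷ D)) (λ D → R⇒ (outside ∷ D)) (λ D → Q∩R (outside ∷ D))))
  where
  swap : ∀ a b c e → (a + b) + (c + e) ≡ (a + c) + (b + e)
  swap = solve-∀

#-empty : ∀ {n} {P : Pred (Subset n) 0ℓ} (P? : Decidable P) → (∀ D → ¬ P D) → # P? ≡ 0
#-empty {zero} P? ¬P with P? []
... | yes p = contradiction p (¬P [])
... | no  _ = refl
#-empty {suc n} P? ¬P = cong₂ _+_ (#-empty _ λ D → ¬P (inside ∷ D)) (#-empty _ λ D → ¬P (outside ∷ D))

#-mono : ∀ {n} {P Q : Pred (Subset n) 0ℓ} (P? : Decidable P) (Q? : Decidable Q) →
         (∀ D → P D → Q D) → # P? ≤ # Q?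
#-mono {zero} P? Q? P⇒Q with P? [] | Q? []
... | no  _ | _     = z≤n
... | yes _ | yes _ = ≤-refl
... | yes p | no ¬q = contradiction (P⇒Q [] p) ¬q
#-mono {suc n} P? Q? P⇒Q = +-mono-≤ (#-mono _ _ λ D → P⇒Q (inside ∷ D)) (#-mono _ _ λ D → P⇒Q (outside ∷ D))

#-cong : ∀ {n} {P Q : Pred (Subset n) 0ℓ} (P? : Decidable P) (Q? : Decidable Q) →
         (∀ D → P D → Q D) → (∀ D → Q D → P D) → # P? ≡ # Q?
#-cong P? Q? P⇒Q Q⇒P = ≤-antisym (#-mono P? Q? P⇒Q) (#-mono Q? P? Q⇒P)

-- Links the recursive count, which suits induction on n, to the list families in the definition of
-- `h`.
length-filter-subsets : ∀ {n} {P : Pred (Subset n) 0ℓ} (P? : Decidable P) → length (filter P? (subsets n)) ≡ # P?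
length-filter-subsets {zero} P? with P? []
... | yes _ = refl
... | no  _ = refl
length-filter-subsets {suc n} P? = begin
  length (filter P? (map (inside ∷_) (subsets n) ++ map (outside ∷_) (subsets n)))
    ≡⟨ cong length (filter-++ P? (map (inside ∷_) (subsets n)) _) ⟩
  length (filter P? (map (inside ∷_) (subsets n)) ++ filter P? (map (outside ∷_) (subsets n)))
    ≡⟨ length-++ (filter P? (map (inside ∷_) (subsets n))) ⟩
  length (filter P? (map (inside ∷_) (subsets n))) + length (filter P? (map (outside ∷_) (subsets n)))
    ≡⟨ cong₂ _+_ (trans (shift (inside ∷_) (subsets n)) (length-filter-subsets λ D → P? (inside ∷ D)))
                 (trans (shift (outside ∷_) (subsets n)) (length-filter-subsets λ D → P? (outside ∷ D))) ⟩
  # P? ∎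
  where
  open ≡-Reasoning
  shift : ∀ f xs → length (filter P? (map f xs)) ≡ length (filter (λ D → P? (f D)) xs)
  shift f []       = refl
  shift f (x ∷ xs) with does (P? (f x))
  ... | true  = cong suc (shift f xs)
  ... | false = shift f xs

-- D is determined by its trace on U, which is arbitrary and accounts for 2^|U|, and by its trace on
-- the complement, which has fewer than k elements.
#-─< : ∀ {n} (U : Subset n) k → # (λ D → ∣ D ─ U ∣ <? k) ≡ 2 ^ ∣ U ∣ * ∑C< ∣ ∁ U ∣ k
#-─< U zero = trans (#-empty (λ D → ∣ D ─ U ∣ <? 0) λ _ ()) (sym (*-zeroʳ (2 ^ ∣ U ∣)))
#-─< [] (suc k) = sym (trans (+-identityʳ _) (∑C<-0 k))
#-─< (inside ∷ U) (suc k) = begin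
  # (λ D → ∣ (inside ∷ D) ─ (inside ∷ U) ∣ <? suc k) + # (λ D → ∣ (outside ∷ D) ─ (inside ∷ U) ∣ <? suc k)
    ≡⟨ cong₂ _+_ (#-─< U (suc k)) (#-─< U (suc k)) ⟩
  2 ^ ∣ U ∣ * s + 2 ^ ∣ U ∣ * s
    ≡⟨ double (2 ^ ∣ U ∣) s ⟩
  2 * 2 ^ ∣ U ∣ * s ∎
  where
  open ≡-Reasoning
  s = ∑C< ∣ ∁ U ∣ (suc k)
  double : ∀ a s → a * s + a * s ≡ 2 * a * s
  double = solve-∀
#-─< (outside ∷ U) (suc k) = begin
  # (λ D → suc ∣ D ─ U ∣ <? suc k) + # (λ D → ∣ D ─ U ∣ <? suc k)
    ≡⟨ cong₂ _+_ (trans (#-cong (λ D → suc ∣ D ─ U ∣ <? suc k) (λ D → ∣ D ─ U ∣ <? k) (λ _ → s≤s⁻¹) (λ _ → s≤s)) (#-─< U k)) (#-─< U (suc k)) ⟩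
  2 ^ u * ∑C< m k + 2 ^ u * ∑C< m (suc k)  ≡⟨ *-distribˡ-+ (2 ^ u) _ _ ⟨
  2 ^ u * (∑C< m k + ∑C< m (suc k))        ≡⟨ cong (2 ^ u *_) (∑C<-pascal m k) ⟨
  2 ^ u * ∑C< (suc m) (suc k)              ∎
  where
  open ≡-Reasoning
  u = ∣ U ∣
  m = ∣ ∁ U ∣

#-< : ∀ n k → # (λ (D : Subset n) → ∣ D ∣ <? k) ≡ ∑C< n k
#-< n k = begin
  # (λ (D : Subset n) → ∣ D ∣ <? k)   ≡⟨ #-cong (λ (D : Subset n) → ∣ D ∣ <? k) (λ D → ∣ D ─ ⊥ ∣ <? k)
                                           (λ D → subst (λ E → ∣ E ∣ < k) (sym (p─⊥≡p D)))
                                           (λ D → subst (λ E → ∣ E ∣ < k) (p─⊥≡p D)) ⟩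
  # (λ (D : Subset n) → ∣ D ─ ⊥ ∣ <? k) ≡⟨ #-─< (⊥ {n}) k ⟩
  2 ^ ∣ ⊥ {n} ∣ * ∑C< ∣ ∁ (⊥ {n}) ∣ k   ≡⟨ cong₂ (λ a b → 2 ^ a * ∑C< b k) (∣⊥∣≡0 n) (trans (∣∁p∣≡n∸∣p∣ (⊥ {n})) (cong (n ∸_) (∣⊥∣≡0 n))) ⟩
  1 * ∑C< n k                           ≡⟨ *-identityˡ _ ⟩
  ∑C< n k                               ∎
  where open ≡-Reasoning

Between : ∀ {n} → Subset n → Subset n → ℕ → Pred (Subset n) 0ℓ
Between S W k D = S ⊆ D × D ⊆ W × ∣ D ∣ ≡ k

between? : ∀ {n} (S W : Subset n) k → Decidable (Between S W k)
between? S W k D = S ⊆? D ×-dec D ⊆? W ×-dec ∣ D ∣ ≟ k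

0∉outside : ∀ {n} {D : Subset n} → zero ∉ outside ∷ D
0∉outside ()

-- Removing S identifies these sets with the j-subsets of W ─ S; Pascal's rule enters at each
-- element of W ─ S.
#-between : ∀ {n} (S W : Subset n) j → S ⊆ W → # (between? S W (∣ S ∣ + j)) ≡ ∣ W ─ S ∣ C j
#-between [] [] zero    _ = refl
#-between [] [] (suc j) _ = refl
#-between (inside ∷ S) (outside ∷ W) j S⊆W with () ← S⊆W here
#-between (inside ∷ S) (inside ∷ W) j S⊆W = trans (cong₂ _+_
  (trans (#-cong _ (between? S W (∣ S ∣ + j))
    (λ _ (S⊆ , ⊆W , eq) → drop-∷-⊆ S⊆ , drop-∷-⊆ ⊆W , suc-injective eq)
    (λ _ (S⊆ , ⊆W , eq) → s⊆s S⊆ , s⊆s ⊆W , cong suc eq)) (#-between S W j (drop-∷-⊆ S⊆W)))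
  (#-empty (λ D → between? (inside ∷ S) (inside ∷ W) (suc ∣ S ∣ + j) (outside ∷ D)) λ _ (S⊆ , _) → 0∉outside (S⊆ here)))
  (+-identityʳ _)
#-between (outside ∷ S) (outside ∷ W) j S⊆W = cong₂ _+_
  (#-empty (λ D → between? (outside ∷ S) (outside ∷ W) (∣ S ∣ + j) (inside ∷ D)) λ _ (_ , ⊆W , _) → 0∉outside (⊆W here))
  (trans (#-cong _ (between? S W (∣ S ∣ + j))
    (λ _ (S⊆ , ⊆W , eq) → drop-∷-⊆ S⊆ , drop-∷-⊆ ⊆W , eq)
    (λ _ (S⊆ , ⊆W , eq) → s⊆s S⊆ , s⊆s ⊆W , eq)) (#-between S W j (drop-∷-⊆ S⊆W)))
#-between (outside ∷ S) (inside ∷ W) zero S⊆W = trans (cong₂ _+_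
  (#-empty (λ D → between? (outside ∷ S) (inside ∷ W) (∣ S ∣ + 0) (inside ∷ D))
    λ D (S⊆ , _ , eq) → <⇒≱ (≤-reflexive eq) (≤-trans (≤-reflexive (+-identityʳ ∣ S ∣)) (p⊆q⇒∣p∣≤∣q∣ (drop-∷-⊆ S⊆))))
  (trans (#-cong _ (between? S W (∣ S ∣ + 0))
    (λ _ (S⊆ , ⊆W , eq) → drop-∷-⊆ S⊆ , drop-∷-⊆ ⊆W , eq)
    (λ _ (S⊆ , ⊆W , eq) → s⊆s S⊆ , out⊆ ⊆W , eq)) (#-between S W 0 (drop-∷-⊆ S⊆W))))
  (trans (nC0≡1 ∣ W ─ S ∣) (sym (nC0≡1 (suc ∣ W ─ S ∣))))
#-between (outside ∷ S) (inside ∷ W) (suc j) S⊆W = trans (cong₂ _+_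
  (trans (#-cong _ (between? S W (∣ S ∣ + j))
    (λ _ (S⊆ , ⊆W , eq) → drop-∷-⊆ S⊆ , drop-∷-⊆ ⊆W , suc-injective (trans eq (+-suc ∣ S ∣ j)))
    (λ _ (S⊆ , ⊆W , eq) → out⊆ S⊆ , s⊆s ⊆W , trans (cong suc eq) (sym (+-suc ∣ S ∣ j)))) (#-between S W j (drop-∷-⊆ S⊆W)))
  (trans (#-cong _ (between? S W (∣ S ∣ + suc j))
    (λ _ (S⊆ , ⊆W , eq) → drop-∷-⊆ S⊆ , drop-∷-⊆ ⊆W , eq)
    (λ _ (S⊆ , ⊆W , eq) → s⊆s S⊆ , out⊆ ⊆W , eq)) (#-between S W (suc j) (drop-∷-⊆ S⊆W))))
  (nCk+nC[k+1]≡[n+1]C[k+1] ∣ W ─ S ∣ j)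

#-cover : ∀ {m n} {P : Pred (Subset n) 0ℓ} {R : Fin m → Pred (Subset n) 0ℓ}
          (P? : Decidable P) (R? : ∀ u → Decidable (R u)) (V : Subset m) c →
          (∀ D → P D → ∃[ u ] u ∈ V × R u D) → (∀ u → u ∈ V → # (R? u) ≤ c) → # P? ≤ ∣ V ∣ * c
#-cover {P = P} {R} P? R? [] c covers _ = ≤-reflexive (#-empty P? empty)
  where
  empty : ∀ D → ¬ P D
  empty D PD with () ← covers D PD
#-cover {P = P} {R} P? R? (outside ∷ V) c covers R≤c =
  #-cover P? (λ u → R? (suc u)) V c shift (λ u u∈V → R≤c (suc u) (there u∈V))
  where
  shift : ∀ D → P D → ∃[ u ] u ∈ V × R (suc u) D
  shift D PD with suc u , there u∈V , r ← covers D PD = u , u∈V , r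
#-cover {P = P} {R} P? R? (inside ∷ V) c covers R≤c = ≤-trans
  (#-subadditive P? (R? zero) rest? split)
  (+-mono-≤ (R≤c zero here) (#-cover rest? (λ u → R? (suc u)) V c shift λ u u∈V → R≤c (suc u) (there u∈V)))
  where
  rest? : Decidable (λ D → P D × ¬ R zero D)
  rest? D = P? D ×-dec ¬? (R? zero D)
  split : ∀ D → P D → R zero D ⊎ P D × ¬ R zero D
  split D PD with R? zero D
  ... | yes r = inj₁ r
  ... | no ¬r = inj₂ (PD , ¬r)
  shift : ∀ D → P D × ¬ R zero D → ∃[ u ] u ∈ V × R (suc u) D
  shift D (PD , ¬r) with covers D PD
  ... | zero  , _        , r = contradiction r ¬r
  ... | suc u , there u∈ , r = u , u∈ , r

∩-mono-∣∣ : ∀ {n} (D : Subset n) {A B} → A ⊆ B → ∣ D ∩ A ∣ ≤ ∣ D ∩ B ∣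
∩-mono-∣∣ D {A} A⊆B = p⊆q⇒∣p∣≤∣q∣ λ x∈ → let x∈D , x∈A = x∈p∩q⁻ D A x∈ in x∈p∩q⁺ (x∈D , A⊆B x∈A)

⊈⇒∣∩∣< : ∀ {n} (T D : Subset n) → T ⊈ D → ∣ T ∩ D ∣ < ∣ T ∣
⊈⇒∣∩∣< T D T⊈D with nonempty? (T ─ D)
... | yes T─D≢∅ = subst (∣ T ∩ D ∣ <_) (∣─∣+∣∩∣ T D) (m<n+m ∣ T ∩ D ∣ (nonempty⇒0< T─D≢∅))
... | no  T─D∅  = ⊥-elim (T⊈D T⊆D)
  where
  T⊆D : T ⊆ D
  T⊆D {x} x∈T = decidable-stable (x ∈? D) λ x∉D → T─D∅ (x , x∈p∧x∉q⇒x∈p─q x∈T x∉D)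

-- This is how a member is shown to have more than t elements in U: its trace contains two sets of
-- at least t elements that share fewer than t.
∣∪∣> : ∀ {n} t (A B : Subset n) → t ≤ ∣ A ∣ → t ≤ ∣ B ∣ → ∣ A ∩ B ∣ < t → t < ∣ A ∪ B ∣
∣∪∣> t A B t≤A t≤B A∩B<t = +-cancelʳ-< t t ∣ A ∪ B ∣ (begin-strict
  t + t                       ≤⟨ +-mono-≤ t≤A t≤B ⟩
  ∣ A ∣ + ∣ B ∣               ≡⟨ ∣∪∣+∣∩∣ A B ⟨
  ∣ A ∪ B ∣ + ∣ A ∩ B ∣       <⟨ +-monoʳ-< ∣ A ∪ B ∣ A∩B<t ⟩
  ∣ A ∪ B ∣ + t               ∎)
  where open ≤-Reasoning

∣─∣≡∸ : ∀ {n} (S W : Subset n) → S ⊆ W → ∣ W ─ S ∣ ≡ ∣ W ∣ ∸ ∣ S ∣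
∣─∣≡∸ S W S⊆W = begin
  ∣ W ─ S ∣                          ≡⟨ m+n∸n≡m ∣ W ─ S ∣ ∣ W ∩ S ∣ ⟨
  ∣ W ─ S ∣ + ∣ W ∩ S ∣ ∸ ∣ W ∩ S ∣  ≡⟨ cong₂ _∸_ (∣─∣+∣∩∣ W S) (cong ∣_∣ W∩S≡S) ⟩
  ∣ W ∣ ∸ ∣ S ∣                      ∎
  where
  open ≡-Reasoning
  W∩S≡S : W ∩ S ≡ S
  W∩S≡S = ⊆-antisym (p∩q⊆q W S) λ x∈S → x∈p∩q⁺ (S⊆W x∈S , x∈S)

#-between-≤ : ∀ {n} (S W : Subset n) j → # (between? S W (∣ S ∣ + j)) ≤ (∣ W ∣ ∸ ∣ S ∣) C j
#-between-≤ S W j with S ⊆? W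
... | yes S⊆W = ≤-reflexive (trans (#-between S W j S⊆W) (cong (_C j) (∣─∣≡∸ S W S⊆W)))
... | no  S⊈W = ≤-trans (≤-reflexive (#-empty (between? S W (∣ S ∣ + j)) λ _ (S⊆D , D⊆W , _) → S⊈W (⊆-trans S⊆D D⊆W))) z≤n

#-⊇-≤ : ∀ {n} (S : Subset n) j → # (between? S ⊤ (∣ S ∣ + j)) ≤ (n ∸ ∣ S ∣) C j
#-⊇-≤ {n} S j = subst (λ w → # (between? S ⊤ (∣ S ∣ + j)) ≤ (w ∸ ∣ S ∣) C j) (∣⊤∣≡n n) (#-between-≤ S ⊤ j)

-- Uniform families with intersection or matching conditions

module _ {n} {F : Pred (Subset n) 0ℓ} (F? : Decidable F) where

  -- Two-sided bounds on |U| suffice: the upper one enters the power of two, the lower one shrinks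
  -- the ground set left outside U.
  #-concentrated : ∀ U {k u} j → (∀ D → F D → ∣ D ─ U ∣ < j) → k ≤ ∣ U ∣ → ∣ U ∣ ≤ u →
                   # F? ≤ 2 ^ u * ∑C< (n ∸ k) j
  #-concentrated U {k} {u} j F⇒ k≤U U≤u = begin
    # F?                            ≤⟨ #-mono F? (λ D → ∣ D ─ U ∣ <? j) F⇒ ⟩
    # (λ D → ∣ D ─ U ∣ <? j)        ≡⟨ #-─< U j ⟩
    2 ^ ∣ U ∣ * ∑C< ∣ ∁ U ∣ j       ≤⟨ *-mono-≤ (^-monoʳ-≤ 2 U≤u) (∑C<-monoˡ j (≤-trans (≤-reflexive (∣∁p∣≡n∸∣p∣ U)) (∸-monoʳ-≤ n k≤U))) ⟩
    2 ^ u * ∑C< (n ∸ k) j           ∎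
    where open ≤-Reasoning

  -- If A and B meet in exactly a t-set T and E ⊉ T, then every member of the
  -- family has more than t elements in A ∪ B ∪ E.
  star-or-small : ∀ t j → (∀ D → F D → ∣ D ∣ ≡ t + j) → (∀ A B → F A → F B → t ≤ ∣ A ∩ B ∣) →
                  (∃[ T ] ∣ T ∣ ≡ t × ∀ D → F D → T ⊆ D) ⊎ # F? ≤ 2 ^ (t + 3 * j) * ∑C< (n ∸ (t + j)) j
  star-or-small t j size meet with anySubset? F?
  ... | no ¬F = inj₂ (≤-trans (≤-reflexive (#-empty F? λ D FD → ¬F (D , FD))) z≤n)
  ... | yes (A , FA) = extend (anySubset? λ B → F? B ×-dec ∣ A ∩ B ∣ ≤? t)
    where
    open ≤-Reasoning

    few-outside : ∀ U D → F D → t < ∣ D ∩ U ∣ → ∣ D ─ U ∣ < j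
    few-outside U D FD t< = +-cancelʳ-< t _ _ (begin-strict
      ∣ D ─ U ∣ + t             <⟨ +-monoʳ-< ∣ D ─ U ∣ t< ⟩
      ∣ D ─ U ∣ + ∣ D ∩ U ∣     ≡⟨ ∣─∣+∣∩∣ D U ⟩
      ∣ D ∣                     ≡⟨ size D FD ⟩
      t + j                     ≡⟨ +-comm t j ⟩
      j + t                     ∎)

    module _ B (FB : F B) (∣T∣≤t : ∣ A ∩ B ∣ ≤ t) where

      T = A ∩ B

      ∣T∣≡t : ∣ T ∣ ≡ t
      ∣T∣≡t = ≤-antisym ∣T∣≤t (meet A B FA FB)

      module _ E (FE : F E) (T⊈E : T ⊈ E) where

        U = (A ∪ B) ∪ E

        A∪B≤ : ∣ A ∪ B ∣ ≤ t + 2 * j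
        A∪B≤ = +-cancelʳ-≤ t _ _ (begin
          ∣ A ∪ B ∣ + t              ≡⟨ cong (∣ A ∪ B ∣ +_) ∣T∣≡t ⟨
          ∣ A ∪ B ∣ + ∣ A ∩ B ∣      ≡⟨ ∣∪∣+∣∩∣ A B ⟩
          ∣ A ∣ + ∣ B ∣              ≡⟨ cong₂ _+_ (size A FA) (size B FB) ⟩
          (t + j) + (t + j)          ≡⟨ regroup t j ⟩
          t + 2 * j + t              ∎)
          where
          regroup : ∀ t j → (t + j) + (t + j) ≡ t + 2 * j + t
          regroup = solve-∀

        -- E meets A in at least t elements and so adds at most j new ones: the third j in t + 3j.
        E─≤ : ∣ E ─ (A ∪ B) ∣ ≤ j
        E─≤ = +-cancelʳ-≤ t _ _ (begin
          ∣ E ─ (A ∪ B) ∣ + t                    ≤⟨ +-monoʳ-≤ ∣ E ─ (A ∪ B) ∣ (≤-trans (meet E A FE FA) (∩-mono-∣∣ E (p⊆p∪q B))) ⟩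
          ∣ E ─ (A ∪ B) ∣ + ∣ E ∩ (A ∪ B) ∣      ≡⟨ ∣─∣+∣∩∣ E (A ∪ B) ⟩
          ∣ E ∣                                  ≡⟨ size E FE ⟩
          t + j                                  ≡⟨ +-comm t j ⟩
          j + t                                  ∎)

        U≤ : ∣ U ∣ ≤ t + 3 * j
        U≤ = begin
          ∣ U ∣                            ≡⟨ ∣∪∣≡ (A ∪ B) E ⟩
          ∣ A ∪ B ∣ + ∣ E ─ (A ∪ B) ∣      ≤⟨ +-mono-≤ A∪B≤ E─≤ ⟩
          (t + 2 * j) + j                  ≡⟨ regroup t j ⟩
          t + 3 * j                        ∎
          where
          regroup : ∀ t j → (t + 2 * j) + j ≡ t + 3 * j
          regroup = solve-∀

        A∪B⊆U : A ∪ B ⊆ U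
        A∪B⊆U = p⊆p∪q E

        ≤U : t + j ≤ ∣ U ∣
        ≤U = subst (_≤ ∣ U ∣) (size A FA) (p⊆q⇒∣p∣≤∣q∣ λ x∈A → A∪B⊆U (p⊆p∪q B x∈A))

        many-inside : ∀ D → F D → t < ∣ D ∩ U ∣
        many-inside D FD with T ⊆? D
        -- D ∩ E and T both lie in D ∩ U, and they share fewer than t elements because T ⊈ E.
        ... | yes T⊆D = ≤-trans
          (∣∪∣> t (D ∩ E) T (meet D E FD FE) (≤-reflexive (sym ∣T∣≡t))
            (≤-<-trans (p⊆q⇒∣p∣≤∣q∣ ⊆T∩E) (subst (∣ T ∩ E ∣ <_) ∣T∣≡t (⊈⇒∣∩∣< T E T⊈E))))
          (p⊆q⇒∣p∣≤∣q∣ ⊆D∩U)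
          where
          ⊆T∩E : (D ∩ E) ∩ T ⊆ T ∩ E
          ⊆T∩E x∈ = let x∈D∩E , x∈T = x∈p∩q⁻ (D ∩ E) T x∈ in x∈p∩q⁺ (x∈T , p∩q⊆q D E x∈D∩E)
          ⊆D∩U : (D ∩ E) ∪ T ⊆ D ∩ U
          ⊆D∩U x∈ with x∈p∪q⁻ (D ∩ E) T x∈
          ... | inj₁ x∈D∩E = let x∈D , x∈E = x∈p∩q⁻ D E x∈D∩E in x∈p∩q⁺ (x∈D , q⊆p∪q (A ∪ B) E x∈E)
          ... | inj₂ x∈T   = x∈p∩q⁺ (T⊆D x∈T , A∪B⊆U (p⊆p∪q B (p∩q⊆p A B x∈T)))
        -- D ∩ A and D ∩ B share only T ∩ D, which now has fewer than t elements.
        ... | no T⊈D = ≤-trans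
          (∣∪∣> t (D ∩ A) (D ∩ B) (meet D A FD FA) (meet D B FD FB)
            (≤-<-trans (p⊆q⇒∣p∣≤∣q∣ ⊆T∩D) (subst (∣ T ∩ D ∣ <_) ∣T∣≡t (⊈⇒∣∩∣< T D T⊈D))))
          (p⊆q⇒∣p∣≤∣q∣ ⊆D∩U)
          where
          ⊆T∩D : (D ∩ A) ∩ (D ∩ B) ⊆ T ∩ D
          ⊆T∩D x∈ = let x∈D∩A , x∈D∩B = x∈p∩q⁻ (D ∩ A) (D ∩ B) x∈
                    in x∈p∩q⁺ (x∈p∩q⁺ (p∩q⊆q D A x∈D∩A , p∩q⊆q D B x∈D∩B) , p∩q⊆p D A x∈D∩A)
          ⊆D∩U : (D ∩ A) ∪ (D ∩ B) ⊆ D ∩ U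
          ⊆D∩U x∈ with x∈p∪q⁻ (D ∩ A) (D ∩ B) x∈
          ... | inj₁ x∈D∩A = let x∈D , x∈A = x∈p∩q⁻ D A x∈D∩A in x∈p∩q⁺ (x∈D , A∪B⊆U (p⊆p∪q B x∈A))
          ... | inj₂ x∈D∩B = let x∈D , x∈B = x∈p∩q⁻ D B x∈D∩B in x∈p∩q⁺ (x∈D , A∪B⊆U (q⊆p∪q A B x∈B))

    extend : Dec (∃[ B ] F B × ∣ A ∩ B ∣ ≤ t) →
             (∃[ T ] ∣ T ∣ ≡ t × ∀ D → F D → T ⊆ D) ⊎ # F? ≤ 2 ^ (t + 3 * j) * ∑C< (n ∸ (t + j)) j
    -- Every member then has more than t elements in A, so A itself serves as U.
    extend (no ¬B) = inj₂ (#-concentrated A j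
      (λ D FD → few-outside A D FD (subst (t <_) (cong ∣_∣ (∩-comm A D)) (≰⇒> λ ≤t → ¬B (D , FD , ≤t))))
      (≤-reflexive (sym (size A FA))) (≤-trans (≤-reflexive (size A FA)) (+-monoʳ-≤ t (m≤m+n j _))))
    extend (yes (B , FB , ∣T∣≤t)) with anySubset? (λ E → F? E ×-dec ¬? (A ∩ B ⊆? E))
    ... | no ¬E = inj₁ (A ∩ B , ∣T∣≡t B FB ∣T∣≤t , λ D FD → decidable-stable (A ∩ B ⊆? D) λ T⊈D → ¬E (D , FD , T⊈D))
    ... | yes (E , FE , T⊈E) = inj₂ (#-concentrated (U B FB ∣T∣≤t E FE T⊈E) j
      (λ D FD → few-outside _ D FD (many-inside B FB ∣T∣≤t E FE T⊈E D FD))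
      (≤U B FB ∣T∣≤t E FE T⊈E) (U≤ B FB ∣T∣≤t E FE T⊈E))

  #-star : ∀ t j T → ∣ T ∣ ≡ t → (∀ D → F D → ∣ D ∣ ≡ t + j) → (∀ D → F D → T ⊆ D) → # F? ≤ (n ∸ t) C j
  #-star t j T refl size T⊆ = ≤-trans (#-mono F? (between? T ⊤ (t + j)) λ D FD → T⊆ D FD , ⊆⊤ , size D FD) (#-⊇-≤ T j)

≢⇒∣⁅⁆∪⁅⁆∣ : ∀ {n} {u v : Fin n} → u ≢ v → ∣ ⁅ u ⁆ ∪ ⁅ v ⁆ ∣ ≡ 2
≢⇒∣⁅⁆∪⁅⁆∣ {u = u} {v} u≢v = trans (disjoint-∣∪∣ ⁅ u ⁆ ⁅ v ⁆ disjoint) (cong₂ _+_ (∣⁅x⁆∣≡1 u) (∣⁅x⁆∣≡1 v))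
  where
  disjoint : Empty (⁅ u ⁆ ∩ ⁅ v ⁆)
  disjoint (x , x∈) = let x∈u , x∈v = x∈p∩q⁻ ⁅ u ⁆ ⁅ v ⁆ x∈ in
    u≢v (trans (sym (x∈⁅y⁆⇒x≡y u x∈u)) (x∈⁅y⁆⇒x≡y v x∈v))

p<2^p : ∀ p → suc p ≤ 2 ^ p
p<2^p zero    = ≤-refl
p<2^p (suc p) = begin
  suc (suc p)        ≤⟨ +-mono-≤ (m^n>0 2 p) (p<2^p p) ⟩
  2 ^ p + 2 ^ p      ≡⟨ cong (2 ^ p +_) (+-identityʳ (2 ^ p)) ⟨
  2 ^ suc p          ∎
  where open ≤-Reasoning

-- (2p + 2)² bounds the number of pairs {u, v} that cover a family without three pairwise disjoint
-- sets. It fits into the factor 2^(3p + 2) because p + 1 ≤ 2^p.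
square≤2^ : ∀ p → (suc p + suc p) * (suc p + suc p) ≤ 2 ^ (3 * p + 2)
square≤2^ p = begin
  (suc p + suc p) * (suc p + suc p)   ≤⟨ *-mono-≤ (+-mono-≤ (p<2^p p) (p<2^p p)) (+-mono-≤ (p<2^p p) (p<2^p p)) ⟩
  (x + x) * (x + x)                   ≡⟨ expand x ⟩
  x * x * 4                           ≤⟨ *-monoˡ-≤ 4 (m≤n*m (x * x) x {{>-nonZero (m^n>0 2 p)}}) ⟩
  x * (x * x) * 4                     ≡⟨ cong (λ y → x * (x * y) * 4) (*-identityʳ x) ⟨
  x ^ 3 * 2 ^ 2                       ≡⟨ cong (_* 2 ^ 2) (trans (^-*-assoc 2 p 3) (cong (2 ^_) (*-comm p 3))) ⟩
  2 ^ (3 * p) * 2 ^ 2                 ≡⟨ ^-distribˡ-+-* 2 (3 * p) 2 ⟨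
  2 ^ (3 * p + 2)                     ∎
  where
  open ≤-Reasoning
  x = 2 ^ p
  expand : ∀ x → (x + x) * (x + x) ≡ x * x * 4
  expand = solve-∀

unions : ∀ {n} → Subset n → Subset n → Subset n → ℕ
unions A B E = ∣ A ∪ B ∣ + ∣ B ∪ E ∣ + ∣ E ∪ A ∣

-- Families of (p + 1)-sets on a large ground set

module LargeGroundSet (r m : ℕ)
                      (sparse  : 2 ^ (3 * suc r + 2) * ∑C< m (suc r) ≤ m C suc r)
                      (sparse′ : 2 ^ (3 * suc r + 2) * ∑C< m r ≤ m C r) where

  -- With p = r + 1 and n = m + 2, the numbers C(n - 2, p) and C(n - 2, p - 1) are `m C p` and
  -- `m C r`; `sparse` measures errors against the former, `sparse′` against the latter.
  p n : ℕ
  p = suc r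
  n = suc (suc m)

  mCp≤ : m C p ≤ suc m C p
  mCp≤ = C-monoˡ m p

  1+3p≤ : 1 + 3 * p ≤ 3 * p + 2
  1+3p≤ = ≤-trans (≤-reflexive (+-comm 1 (3 * p))) (+-monoʳ-≤ (3 * p) (s≤s z≤n))

  -- With at least two elements in U, at most m = n - 2 elements lie outside it, and `sparse`
  -- applies.
  negligible : ∀ {e k} → e ≤ 3 * p + 2 → 2 ≤ k → 2 ^ e * ∑C< (n ∸ k) p ≤ m C p
  negligible e≤ 2≤k = ≤-trans (*-mono-≤ (^-monoʳ-≤ 2 e≤) (∑C<-monoˡ p (∸-monoʳ-≤ n 2≤k))) sparse

  module _ {F : Pred (Subset n) 0ℓ} (F? : Decidable F) where

    #-concentrated≤ : ∀ U → (∀ D → F D → ∣ D ─ U ∣ < p) → 2 ≤ ∣ U ∣ → ∣ U ∣ ≤ 3 * p + 2 → # F? ≤ m C p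
    #-concentrated≤ U F⇒ 2≤ ≤u = ≤-trans (#-concentrated F? U p F⇒ 2≤ ≤u) (negligible ≤-refl ≤-refl)

    #-intersecting : (∀ D → F D → ∣ D ∣ ≡ suc p) → (∀ A B → F A → F B → 1 ≤ ∣ A ∩ B ∣) → # F? ≤ suc m C p
    #-intersecting size meet with star-or-small F? 1 p size meet
    ... | inj₁ (T , ∣T∣≡1 , T⊆) = #-star F? 1 p T ∣T∣≡1 size T⊆
    ... | inj₂ small = ≤-trans small (≤-trans (negligible {k = suc p} 1+3p≤ (s≤s (s≤s z≤n))) mCp≤)

    #-2-intersecting : (∀ D → F D → ∣ D ∣ ≡ suc p) → (∀ A B → F A → F B → 2 ≤ ∣ A ∩ B ∣) → # F? ≤ m C r
    #-2-intersecting size meet with star-or-small F? 2 r size meet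
    ... | inj₁ (T , ∣T∣≡2 , T⊆) = #-star F? 2 r T ∣T∣≡2 size T⊆
    ... | inj₂ small = ≤-trans small (≤-trans
      (*-mono-≤ (^-monoʳ-≤ 2 (≤-trans (≤-reflexive (+-comm 2 (3 * r))) (+-monoˡ-≤ 2 (*-monoʳ-≤ 3 (n≤1+n r)))))
                (∑C<-monoˡ r (∸-monoʳ-≤ n (m≤m+n 2 r))))
      sparse′)

  -- Either deleting one vertex a makes the family intersecting, or every vertex u is
  -- avoided by a disjoint pair, whose union then meets all members through u: few
  -- pairs {u, v} cover the family.
  #-no-3-matching : {F : Pred (Subset n) 0ℓ} (F? : Decidable F) → (∀ D → F D → ∣ D ∣ ≡ suc p) →
                    (∀ A B E → F A → F B → F E → Empty (A ∩ B) → Nonempty (E ∩ (A ∪ B))) →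
                    # F? ≤ suc m C p + m C p
  #-no-3-matching {F} F? size blocked = conclude (Fin.any? λ a → ¬? (avoided? a))
    where
    AvoidedBy : Fin n → Subset n → Subset n → Set
    AvoidedBy a A B = (F A × a ∉ A) × (F B × a ∉ B) × Empty (A ∩ B)

    avoided? : ∀ a → Dec (∃[ A ] ∃[ B ] AvoidedBy a A B)
    avoided? a = anySubset? λ A → anySubset? λ B →
      (F? A ×-dec ¬? (a ∈? A)) ×-dec (F? B ×-dec ¬? (a ∈? B)) ×-dec ¬? (nonempty? (A ∩ B))

    module _ (a : Fin n) (¬avoided : ¬ (∃[ A ] ∃[ B ] AvoidedBy a A B)) where
      F∌a? : Decidable (λ D → F D × a ∉ D)
      F∌a? D = F? D ×-dec ¬? (a ∈? D)

      F∌a-meet : ∀ A B → F A × a ∉ A → F B × a ∉ B → 1 ≤ ∣ A ∩ B ∣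
      F∌a-meet A B FA FB = nonempty⇒0< (decidable-stable (nonempty? (A ∩ B)) λ ∅ → ¬avoided (A , B , FA , FB , ∅))

      #F∌a : # F∌a? ≤ m C p
      #F∌a with star-or-small F∌a? 1 p (λ D (FD , _) → size D FD) F∌a-meet
      ... | inj₂ small = ≤-trans small (negligible {k = suc p} 1+3p≤ (s≤s (s≤s z≤n)))
      -- Members of this star also avoid a, so they lie between T and the complement of a: hence C(n
      -- - 2, p) rather than C(n - 1, p).
      ... | inj₁ (T , ∣T∣≡1 , T⊆) = begin
        # F∌a?                                   ≤⟨ #-mono F∌a? (between? T (∁ ⁅ a ⁆) (∣ T ∣ + p)) in-interval ⟩
        # (between? T (∁ ⁅ a ⁆) (∣ T ∣ + p))     ≤⟨ #-between-≤ T (∁ ⁅ a ⁆) p ⟩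
        (∣ ∁ ⁅ a ⁆ ∣ ∸ ∣ T ∣) C p                ≡⟨ cong₂ (λ x y → (x ∸ y) C p) (trans (∣∁p∣≡n∸∣p∣ ⁅ a ⁆) (cong (n ∸_) (∣⁅x⁆∣≡1 a))) ∣T∣≡1 ⟩
        m C p                                    ∎
        where
        open ≤-Reasoning
        in-interval : ∀ D → F D × a ∉ D → Between T (∁ ⁅ a ⁆) (∣ T ∣ + p) D
        in-interval D (FD , a∉D) = T⊆ D (FD , a∉D)
          , (λ x∈D → x∉p⇒x∈∁p λ x∈a → a∉D (subst (_∈ D) (x∈⁅y⁆⇒x≡y a x∈a) x∈D))
          , trans (size D FD) (cong (_+ p) (sym ∣T∣≡1))

      F∋a? : Decidable (λ D → F D × a ∈ D)
      F∋a? D = F? D ×-dec a ∈? D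

      #F∋a : # F∋a? ≤ suc m C p
      #F∋a = #-star F∋a? 1 p ⁅ a ⁆ (∣⁅x⁆∣≡1 a) (λ D (FD , _) → size D FD)
        λ D (_ , a∈D) x∈ → subst (_∈ D) (sym (x∈⁅y⁆⇒x≡y a x∈)) a∈D

      split : ∀ D → F D → (F D × a ∈ D) ⊎ (F D × a ∉ D)
      split D FD with a ∈? D
      ... | yes a∈D = inj₁ (FD , a∈D)
      ... | no  a∉D = inj₂ (FD , a∉D)

    module _ (avoided : ∀ a → ∃[ A ] ∃[ B ] AvoidedBy a A B) where
      V : Fin n → Subset n
      V a = let A , B , _ = avoided a in A ∪ B

      ∣V∣≤ : ∀ a → ∣ V a ∣ ≤ suc p + suc p
      ∣V∣≤ a = let A , B , (FA , _) , (FB , _) , _ = avoided a in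
        ≤-trans (∣∪∣≤ A B) (≤-reflexive (cong₂ _+_ (size A FA) (size B FB)))

      -- Makes u distinct from every v in V u, so that the members through both are counted by C(n -
      -- 2, p - 1).
      ∉V : ∀ a → a ∉ V a
      ∉V a a∈ with avoided a
      ... | A , B , (_ , a∉A) , (_ , a∉B) , _ with x∈p∪q⁻ A B a∈
      ... | inj₁ a∈A = a∉A a∈A
      ... | inj₂ a∈B = a∉B a∈B

      hits : ∀ a D → F D → ∃[ v ] v ∈ V a × v ∈ D
      hits a D FD = let A , B , (FA , _) , (FB , _) , ∅ = avoided a
                        v , v∈ = blocked A B D FA FB FD ∅
                        v∈D , v∈V = x∈p∩q⁻ D (V a) v∈
                    in v , v∈V , v∈D

      through? : ∀ u → Decidable (λ D → F D × u ∈ D)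
      through? u D = F? D ×-dec u ∈? D

      through₂? : ∀ u v → Decidable (λ D → F D × u ∈ D × v ∈ D)
      through₂? u v D = F? D ×-dec u ∈? D ×-dec v ∈? D

      #through₂ : ∀ u v → v ∈ V u → # (through₂? u v) ≤ m C r
      #through₂ u v v∈ = #-star (through₂? u v) 2 r (⁅ u ⁆ ∪ ⁅ v ⁆)
        (≢⇒∣⁅⁆∪⁅⁆∣ λ u≡v → ∉V u (subst (_∈ V u) (sym u≡v) v∈)) (λ D (FD , _) → size D FD) contains
        where
        contains : ∀ D → F D × u ∈ D × v ∈ D → ⁅ u ⁆ ∪ ⁅ v ⁆ ⊆ D
        contains D (_ , u∈D , v∈D) x∈ with x∈p∪q⁻ ⁅ u ⁆ ⁅ v ⁆ x∈
        ... | inj₁ x∈u = subst (_∈ D) (sym (x∈⁅y⁆⇒x≡y u x∈u)) u∈D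
        ... | inj₂ x∈v = subst (_∈ D) (sym (x∈⁅y⁆⇒x≡y v x∈v)) v∈D

      #through : ∀ u → # (through? u) ≤ (suc p + suc p) * (m C r)
      #through u = ≤-trans
        (#-cover (through? u) (through₂? u) (V u) (m C r)
          (λ D (FD , u∈D) → let v , v∈V , v∈D = hits u D FD in v , v∈V , FD , u∈D , v∈D) (#through₂ u))
        (*-monoˡ-≤ (m C r) (∣V∣≤ u))

      #-covered : # F? ≤ m C p
      #-covered = begin
        # F?                                                ≤⟨ #-cover F? through? (V zero) ((suc p + suc p) * (m C r))
                                                                 (λ D FD → let u , u∈V , u∈D = hits zero D FD in u , u∈V , FD , u∈D) (λ u _ → #through u) ⟩
        ∣ V zero ∣ * ((suc p + suc p) * (m C r))            ≤⟨ *-monoˡ-≤ _ (∣V∣≤ zero) ⟩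
        (suc p + suc p) * ((suc p + suc p) * (m C r))       ≡⟨ *-assoc (suc p + suc p) (suc p + suc p) (m C r) ⟨
        (suc p + suc p) * (suc p + suc p) * (m C r)         ≤⟨ *-mono-≤ (square≤2^ p) (m≤n+m (m C r) (∑C< m r)) ⟩
        2 ^ (3 * p + 2) * ∑C< m p                           ≤⟨ sparse ⟩
        m C p                                               ∎
        where open ≤-Reasoning

    conclude : Dec (∃[ a ] ¬ (∃[ A ] ∃[ B ] AvoidedBy a A B)) → # F? ≤ suc m C p + m C p
    conclude (yes (a , ¬av)) = ≤-trans (#-subadditive F? (F∋a? a ¬av) (F∌a? a ¬av) (split a ¬av)) (+-mono-≤ (#F∋a a ¬av) (#F∌a a ¬av))
    conclude (no ¬∃) = ≤-trans (#-covered λ a → decidable-stable (avoided? a) λ ¬av → ¬∃ (a , ¬av)) (m≤n+m _ _)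

  -- Size and intersection constraints in large downsets

  module Downset {Q : Pred (Subset n) 0ℓ} (Q? : Decidable Q) (down : ∀ {D E} → D ⊆ E → Q E → Q D)
                 (q : ℕ) (unions≤ : ∀ {A B E} → Q A → Q B → Q E → unions A B E ≤ 6 * p + q)
                 (large : m C p < # Q?) where

    -- Otherwise all members are concentrated on U and there are too few of them.
    escape : ∀ U → 2 ≤ ∣ U ∣ → ∣ U ∣ ≤ 3 * p + 2 → ∃[ B ] Q B × ∣ B ∣ ≡ p × Empty (U ∩ B)
    escape U 2≤ ≤u with anySubset? (λ D → Q? D ×-dec p ≤? ∣ D ─ U ∣)
    ... | no ¬D = contradiction (#-concentrated≤ Q? U (λ D QD → ≰⇒> λ p≤ → ¬D (D , QD , p≤)) 2≤ ≤u) (<⇒≱ large)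
    ... | yes (D , QD , p≤) = let B , B⊆ , ∣B∣≡p = choose p (D ─ U) p≤ in
      B , down (λ x∈B → p─q⊆p D U (B⊆ x∈B)) QD , ∣B∣≡p ,
      λ (x , x∈) → let x∈U , x∈B = x∈p∩q⁻ U B x∈ in ∈─⇒∉ D U (B⊆ x∈B) x∈U

    -- A p-set E of the family that avoids A ∪ B has |B ∪ E| = |B| + p and |E ∪ A| = |A| + p, so the
    -- condition on triples becomes one on pairs.
    pair-bound : ∀ {A B} → Q A → Q B → 2 ≤ ∣ A ∪ B ∣ → ∣ A ∪ B ∣ ≤ 3 * p + 2 → ∣ A ∪ B ∣ + ∣ A ∣ + ∣ B ∣ ≤ 4 * p + q
    pair-bound {A} {B} QA QB 2≤ ≤u = +-cancelʳ-≤ (2 * p) _ _ (begin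
      ∣ A ∪ B ∣ + ∣ A ∣ + ∣ B ∣ + 2 * p           ≡⟨ regroup (∣ A ∪ B ∣) (∣ A ∣) (∣ B ∣) p ⟩
      ∣ A ∪ B ∣ + (∣ B ∣ + p) + (∣ A ∣ + p)       ≡⟨ cong₂ (λ x y → ∣ A ∪ B ∣ + x + y) (meets-∅ B (q⊆p∪q A B)) (trans (meets-∅ A (p⊆p∪q B)) (cong ∣_∣ (∪-comm A E))) ⟩
      ∣ A ∪ B ∣ + ∣ B ∪ E ∣ + ∣ E ∪ A ∣           ≤⟨ unions≤ QA QB QE ⟩
      6 * p + q                                   ≡⟨ regroup′ p q ⟩
      4 * p + q + 2 * p                           ∎)
      where
      open ≤-Reasoning
      escaped = escape (A ∪ B) 2≤ ≤u
      E = proj₁ escaped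
      QE = proj₁ (proj₂ escaped)
      meets-∅ : ∀ X → X ⊆ A ∪ B → ∣ X ∣ + p ≡ ∣ X ∪ E ∣
      meets-∅ X X⊆ = trans (cong (∣ X ∣ +_) (sym (proj₁ (proj₂ (proj₂ escaped)))))
        (sym (disjoint-∣∪∣ X E λ (x , x∈) → let x∈X , x∈E = x∈p∩q⁻ X E x∈ in
          proj₂ (proj₂ (proj₂ escaped)) (x , x∈p∩q⁺ (X⊆ x∈X , x∈E))))
      regroup : ∀ u a b p → u + a + b + 2 * p ≡ u + (b + p) + (a + p)
      regroup = solve-∀
      regroup′ : ∀ p q → 6 * p + q ≡ 4 * p + q + 2 * p
      regroup′ = solve-∀

    -- Trim D to a set A of exactly s elements and take a p-set B disjoint from it: `pair-bound`
    -- reads (s + p) + s + p ≤ 4p + q, that is 2s ≤ 2p + q. Trimming keeps A ∪ B within the range of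
    -- `escape`.
    size-bound : ∀ s → 2 ≤ s → s + p ≤ 3 * p + 2 → 2 * p + q < s + s → ∀ D → Q D → ∣ D ∣ < s
    size-bound s 2≤s s≤ q<s D QD = ≰⇒> λ s≤D →
      let A , A⊆D , ∣A∣≡s = choose s D s≤D
          2≤A = subst (2 ≤_) (sym ∣A∣≡s) 2≤s
          B , QB , ∣B∣≡p , ∅ = escape A 2≤A (≤-trans (≤-reflexive ∣A∣≡s) (≤-trans (m≤m+n s p) s≤))
          A∪B≡ = trans (disjoint-∣∪∣ A B ∅) (cong₂ _+_ ∣A∣≡s ∣B∣≡p)
          bound = pair-bound (down A⊆D QD) QB (≤-trans 2≤A (∣p∣≤∣p∪q∣ A B)) (≤-trans (≤-reflexive A∪B≡) s≤)
          bound′ = subst (_≤ 4 * p + q) (cong₂ _+_ (cong₂ _+_ A∪B≡ ∣A∣≡s) ∣B∣≡p) bound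
      in <⇒≱ q<s (+-cancelʳ-≤ (2 * p) _ _ (≤-trans (≤-reflexive (regroup s p)) (≤-trans bound′ (≤-reflexive (regroup′ p q)))))
      where
      regroup : ∀ s p → s + s + 2 * p ≡ s + p + s + p
      regroup = solve-∀
      regroup′ : ∀ p q → 4 * p + q ≡ 2 * p + q + 2 * p
      regroup′ = solve-∀

    layer? : ∀ k → Decidable (λ D → Q D × ∣ D ∣ ≡ k)
    layer? k D = Q? D ×-dec ∣ D ∣ ≟ k

    #≤-layer : (∀ D → Q D → ∣ D ∣ < 2 + p) → # Q? ≤ ∑C< n (suc p) + # (layer? (suc p))
    #≤-layer size = ≤-trans (#-subadditive Q? (λ D → ∣ D ∣ <? suc p) (layer? (suc p)) split)
                            (+-monoˡ-≤ _ (≤-reflexive (#-< n (suc p))))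
      where
      split : ∀ D → Q D → ∣ D ∣ < suc p ⊎ Q D × ∣ D ∣ ≡ suc p
      split D QD with m≤n⇒m<n∨m≡n (s≤s⁻¹ (size D QD))
      ... | inj₁ <p = inj₁ <p
      ... | inj₂ ≡p = inj₂ (QD , ≡p)

    layer-∪ : ∀ (A B : Subset n) {k} → ∣ A ∣ ≡ k → ∣ B ∣ ≡ k → ∣ A ∪ B ∣ ≤ k + k
    layer-∪ A B ∣A∣ ∣B∣ = ≤-trans (∣∪∣≤ A B) (≤-reflexive (cong₂ _+_ ∣A∣ ∣B∣))

    2p+2≤ : suc p + suc p ≤ 3 * p + 2
    2p+2≤ = ≤-trans (≤-reflexive (regroup p)) (+-monoˡ-≤ 2 (m≤n+m (2 * p) p))
      where
      regroup : ∀ p → suc p + suc p ≡ 2 * p + 2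
      regroup = solve-∀

    2p+3≤ : (2 + p) + suc p ≤ 3 * p + 2
    2p+3≤ = ≤-trans (m≤n+m _ r) (≤-reflexive (regroup r))
      where
      regroup : ∀ r → r + ((2 + suc r) + suc (suc r)) ≡ 3 * suc r + 2
      regroup = solve-∀

    2≤-layer-∪ : ∀ (A B : Subset n) → ∣ A ∣ ≡ suc p → 2 ≤ ∣ A ∪ B ∣
    2≤-layer-∪ A B ∣A∣≡ = ≤-trans (subst (2 ≤_) (sym ∣A∣≡) (s≤s (s≤s z≤n))) (∣p∣≤∣p∪q∣ A B)

    layer-∩ : ∀ (A B : Subset n) → ∣ A ∣ ≡ suc p → ∣ B ∣ ≡ suc p → ∣ A ∪ B ∣ + ∣ A ∩ B ∣ ≡ suc p + suc p
    layer-∩ A B ∣A∣≡ ∣B∣≡ = trans (∣∪∣+∣∩∣ A B) (cong₂ _+_ ∣A∣≡ ∣B∣≡)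

    upper₁ : q ≤ 1 → # Q? ≤ ∑C< n (suc p)
    upper₁ q≤1 = ≤-trans (#-mono Q? (λ D → ∣ D ∣ <? suc p) small) (≤-reflexive (#-< n (suc p)))
      where
      regroup : ∀ p → suc (2 * p + 1) ≡ suc p + suc p
      regroup = solve-∀
      small : ∀ D → Q D → ∣ D ∣ < suc p
      small = size-bound (suc p) (s≤s (s≤s z≤n)) (≤-trans (+-monoʳ-≤ (suc p) (n≤1+n p)) 2p+2≤)
        (≤-trans (s≤s (+-monoʳ-≤ (2 * p) q≤1)) (≤-reflexive (regroup p)))

    -- For (p + 1)-sets |A ∪ B| = 2p + 2 - |A ∩ B|, so `pair-bound` gives |A ∩ B| ≥ 4 - q.
    upper₂ : q ≤ 2 → # Q? ≤ ∑C< n (suc p) + m C r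
    upper₂ q≤2 = ≤-trans (#≤-layer small) (+-monoʳ-≤ _
      (#-2-intersecting (layer? (suc p)) (λ _ → proj₂) meet))
      where
      regroup : ∀ p → 2 * p + 4 ≡ (2 + p) + (2 + p)
      regroup = solve-∀
      small : ∀ D → Q D → ∣ D ∣ < 2 + p
      small = size-bound (2 + p) (s≤s (s≤s z≤n)) (≤-trans (≤-reflexive (sym (+-suc (suc p) p))) 2p+2≤)
        (≤-trans (≤-reflexive (sym (+-suc (2 * p) q))) (≤-trans (+-monoʳ-≤ (2 * p) (m≤n⇒m≤1+n (s≤s q≤2))) (≤-reflexive (regroup p))))
      count : ∀ u i p q → u + suc p + suc p ≤ 4 * p + q → u + i ≡ suc p + suc p → 4 ≤ q + i
      count u i p q u≤ u+i = +-cancelˡ-≤ (4 * p) _ _ (begin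
        4 * p + 4                        ≡⟨ regroup₁ p ⟩
        suc p + suc p + suc p + suc p    ≡⟨ cong (λ z → z + suc p + suc p) u+i ⟨
        u + i + suc p + suc p            ≡⟨ regroup₂ u i p ⟩
        u + suc p + suc p + i            ≤⟨ +-monoˡ-≤ i u≤ ⟩
        4 * p + q + i                    ≡⟨ +-assoc (4 * p) q i ⟩
        4 * p + (q + i)                  ∎)
        where
        open ≤-Reasoning
        regroup₁ : ∀ p → 4 * p + 4 ≡ suc p + suc p + suc p + suc p
        regroup₁ = solve-∀
        regroup₂ : ∀ u i p → u + i + suc p + suc p ≡ u + suc p + suc p + i
        regroup₂ = solve-∀
      meet : ∀ A B → Q A × ∣ A ∣ ≡ suc p → Q B × ∣ B ∣ ≡ suc p → 2 ≤ ∣ A ∩ B ∣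
      meet A B (QA , ∣A∣≡) (QB , ∣B∣≡) = +-cancelˡ-≤ 2 _ _ (≤-trans
        (count (∣ A ∪ B ∣) (∣ A ∩ B ∣) p q
          (subst₂ (λ a b → ∣ A ∪ B ∣ + a + b ≤ 4 * p + q) ∣A∣≡ ∣B∣≡
            (pair-bound QA QB (2≤-layer-∪ A B ∣A∣≡) (≤-trans (layer-∪ A B ∣A∣≡ ∣B∣≡) 2p+2≤)))
          (layer-∩ A B ∣A∣≡ ∣B∣≡))
        (+-monoˡ-≤ ∣ A ∩ B ∣ q≤2))

    -- `size-bound` excludes (p + 2)-sets only for q ≤ 3. Beyond that, one such set A, if present,
    -- is used to constrain all other members.
    small-or-big : (∀ D → Q D → ∣ D ∣ < 2 + p) ⊎ (∃[ A ] Q A × ∣ A ∣ ≡ 2 + p)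
    small-or-big with anySubset? (layer? (2 + p))
    ... | yes A = inj₂ A
    ... | no ¬A = inj₁ λ D QD → ≰⇒> λ 2+p≤ → let A , A⊆D , ∣A∣≡ = choose (2 + p) D 2+p≤ in ¬A (A , down A⊆D QD , ∣A∣≡)

    module Big (q≤5 : q ≤ 5) A (QA : Q A) (∣A∣≡ : ∣ A ∣ ≡ 2 + p) where

      2≤A : 2 ≤ ∣ A ∣
      2≤A = subst (2 ≤_) (sym ∣A∣≡) (s≤s (s≤s z≤n))

      -- Otherwise p + 1 elements of D outside A form a member E with |A ∪ E| + |A| + |E| = (2p + 3)
      -- + (p + 2) + (p + 1) = 4p + 6, more than `pair-bound` allows.
      outside≤ : ∀ D → Q D → ∣ D ─ A ∣ ≤ p
      outside≤ D QD = s≤s⁻¹ (≰⇒> λ p<D─A →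
        let E , E⊆ , ∣E∣≡ = choose (suc p) (D ─ A) p<D─A
            A∪E≡ = trans (disjoint-∣∪∣ A E λ (x , x∈) → let x∈A , x∈E = x∈p∩q⁻ A E x∈ in ∈─⇒∉ D A (E⊆ x∈E) x∈A)
                         (cong₂ _+_ ∣A∣≡ ∣E∣≡)
            bound = pair-bound QA (down (λ x∈E → p─q⊆p D A (E⊆ x∈E)) QD)
                      (≤-trans 2≤A (∣p∣≤∣p∪q∣ A E)) (≤-trans (≤-reflexive A∪E≡) 2p+3≤)
        in <⇒≱ (s≤s q≤5) (+-cancelˡ-≤ (4 * p) _ _ (≤-trans (≤-reflexive (regroup p))
             (subst (_≤ 4 * p + q) (cong₂ _+_ (cong₂ _+_ A∪E≡ ∣A∣≡) ∣E∣≡) bound))))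
        where
        regroup : ∀ p → 4 * p + 6 ≡ (2 + p) + suc p + (2 + p) + suc p
        regroup = solve-∀

      A∪≡ : ∀ D → ∣ D ─ A ∣ ≡ p → ∣ A ∪ D ∣ ≡ 2 + p + p
      A∪≡ D D─A≡ = trans (∣∪∣≡ A D) (cong₂ _+_ ∣A∣≡ D─A≡)

      -- Here |A ∪ D| = 2p + 2, so `pair-bound` leaves |D| ≤ p + q - 4: at most p elements for q ≤
      -- 4, and at most p + 1 for q = 5.
      boundary-size : ∀ D → Q D → ∣ D ─ A ∣ ≡ p → 4 + ∣ D ∣ ≤ p + q
      boundary-size D QD D─A≡ = +-cancelˡ-≤ (3 * p) _ _ (≤-trans (≤-reflexive (regroup p (∣ D ∣))) (≤-trans
        (subst (λ z → z + ∣ D ∣ ≤ 4 * p + q) (cong₂ _+_ (A∪≡ D D─A≡) ∣A∣≡)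
          (pair-bound QA QD (≤-trans 2≤A (∣p∣≤∣p∪q∣ A D))
            (≤-trans (≤-reflexive (trans (A∪≡ D D─A≡) (sym (+-suc (suc p) p)))) 2p+2≤)))
        (≤-reflexive (regroup′ p q))))
        where
        regroup : ∀ p k → 3 * p + (4 + k) ≡ (2 + p + p) + (2 + p) + k
        regroup = solve-∀
        regroup′ : ∀ p q → 4 * p + q ≡ 3 * p + (p + q)
        regroup′ = solve-∀

      inner? : Decidable (λ D → Q D × ∣ D ─ A ∣ < p)
      inner? D = Q? D ×-dec ∣ D ─ A ∣ <? p

      #inner : # inner? ≤ m C p
      #inner = #-concentrated≤ inner? A (λ _ → proj₂) 2≤A (≤-trans (≤-reflexive ∣A∣≡)
        (≤-trans (m≤m+n (2 + p) (suc p)) 2p+3≤))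

      boundary? : Decidable (λ D → Q D × suc p ≤ ∣ D ∣ × ∣ D ─ A ∣ ≡ p)
      boundary? D = Q? D ×-dec suc p ≤? ∣ D ∣ ×-dec ∣ D ─ A ∣ ≟ p

      -- A member with more than p elements has exactly p of them outside A or is concentrated on A.
      -- The concentrated ones cost C(n - 2, p), which is the last term of the bound for q = 5 and
      -- stays below C(n - 1, p) for q ≤ 4.
      #≤ : # Q? ≤ ∑C< n (suc p) + (# boundary? + m C p)
      #≤ = ≤-trans (#-subadditive Q? (λ D → ∣ D ∣ <? suc p) rest? split)
        (+-mono-≤ (≤-reflexive (#-< n (suc p))) (≤-trans (#-subadditive rest? boundary? inner? λ _ → id) (+-monoʳ-≤ (# boundary?) #inner)))
        where
        rest? : Decidable (λ D → (Q D × suc p ≤ ∣ D ∣ × ∣ D ─ A ∣ ≡ p) ⊎ (Q D × ∣ D ─ A ∣ < p))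
        rest? D = boundary? D ⊎-dec inner? D
        split : ∀ D → Q D → ∣ D ∣ < suc p ⊎ ((Q D × suc p ≤ ∣ D ∣ × ∣ D ─ A ∣ ≡ p) ⊎ (Q D × ∣ D ─ A ∣ < p))
        split D QD with ∣ D ∣ <? suc p | m≤n⇒m<n∨m≡n (outside≤ D QD)
        ... | yes <p | _       = inj₁ <p
        ... | no  ≮p | inj₁ <p = inj₂ (inj₂ (QD , <p))
        ... | no  ≮p | inj₂ ≡p = inj₂ (inj₁ (QD , ≮⇒≥ ≮p , ≡p))

    upper₄ : q ≤ 4 → # Q? ≤ ∑C< n (suc p) + suc m C p
    upper₄ q≤4 with small-or-big
    ... | inj₂ (A , QA , ∣A∣≡) = ≤-trans #≤ (+-monoʳ-≤ _ (≤-trans (+-monoˡ-≤ (m C p) (≤-reflexive (#-empty boundary? no-boundary))) mCp≤))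
      where
      open Big (m≤n⇒m≤1+n q≤4) A QA ∣A∣≡
      no-boundary : ∀ D → ¬ (Q D × suc p ≤ ∣ D ∣ × ∣ D ─ A ∣ ≡ p)
      no-boundary D (QD , p<D , D─A≡) = <⇒≱ p<D (+-cancelˡ-≤ 4 _ _ (≤-trans (boundary-size D QD D─A≡)
        (≤-trans (+-monoʳ-≤ p q≤4) (≤-reflexive (+-comm p 4)))))
    ... | inj₁ small = ≤-trans (#≤-layer small) (+-monoʳ-≤ _ #layer)
      where
      F? = layer? (suc p)
      -- Submodularity: B ∪ E and E ∪ A have union A ∪ B ∪ E, and both contain E.
      three-unions : ∀ {n} (A B E : Subset n) → ∣ A ∪ B ∣ + ∣ E ─ (A ∪ B) ∣ + ∣ E ∣ ≤ ∣ B ∪ E ∣ + ∣ E ∪ A ∣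
      three-unions A B E = begin
        ∣ A ∪ B ∣ + ∣ E ─ (A ∪ B) ∣ + ∣ E ∣                ≡⟨ cong (_+ ∣ E ∣) (∣∪∣≡ (A ∪ B) E) ⟨
        ∣ (A ∪ B) ∪ E ∣ + ∣ E ∣                            ≤⟨ +-mono-≤ (p⊆q⇒∣p∣≤∣q∣ ⊆∪) (p⊆q⇒∣p∣≤∣q∣ ⊆∩) ⟩
        ∣ (B ∪ E) ∪ (E ∪ A) ∣ + ∣ (B ∪ E) ∩ (E ∪ A) ∣      ≡⟨ ∣∪∣+∣∩∣ (B ∪ E) (E ∪ A) ⟩
        ∣ B ∪ E ∣ + ∣ E ∪ A ∣                              ∎
        where
        open ≤-Reasoning
        ⊆∪ : (A ∪ B) ∪ E ⊆ (B ∪ E) ∪ (E ∪ A)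
        ⊆∪ x∈ with x∈p∪q⁻ (A ∪ B) E x∈
        ... | inj₂ x∈E = p⊆p∪q (E ∪ A) (q⊆p∪q B E x∈E)
        ... | inj₁ x∈A∪B with x∈p∪q⁻ A B x∈A∪B
        ... | inj₁ x∈A = q⊆p∪q (B ∪ E) (E ∪ A) (q⊆p∪q E A x∈A)
        ... | inj₂ x∈B = p⊆p∪q (E ∪ A) (p⊆p∪q E x∈B)
        ⊆∩ : E ⊆ (B ∪ E) ∩ (E ∪ A)
        ⊆∩ x∈E = x∈p∩q⁺ (q⊆p∪q B E x∈E , p⊆p∪q A x∈E)
      regroup : ∀ p → 5 + 6 * p ≡ (suc p + suc p) + ((suc p + suc p) + p + suc p)
      regroup = solve-∀
      #layer : # F? ≤ suc m C p
      #layer with anySubset? (λ A → anySubset? λ B → F? A ×-dec F? B ×-dec ¬? (nonempty? (A ∩ B)))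
      ... | no ¬disjoint = #-intersecting F? (λ _ → proj₂) λ A B FA FB →
        nonempty⇒0< (decidable-stable (nonempty? (A ∩ B)) λ ∅ → ¬disjoint (A , B , FA , FB , ∅))
      ... | yes (A , B , (QA , ∣A∣≡) , (QB , ∣B∣≡) , ∅) =
        ≤-trans (#-concentrated≤ F? (A ∪ B) few (2≤-layer-∪ A B ∣A∣≡) (≤-trans (layer-∪ A B ∣A∣≡ ∣B∣≡) 2p+2≤)) mCp≤
        where
        A∪B≡ : ∣ A ∪ B ∣ ≡ suc p + suc p
        A∪B≡ = trans (disjoint-∣∪∣ A B ∅) (cong₂ _+_ ∣A∣≡ ∣B∣≡)
        -- With A and B disjoint, p elements of E outside A ∪ B would force a total of at least (2p
        -- + 2) + (3p + 2) + (p + 1) = 6p + 5.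
        few : ∀ E → Q E × ∣ E ∣ ≡ suc p → ∣ E ─ (A ∪ B) ∣ < p
        few E (QE , ∣E∣≡) = ≰⇒> λ p≤ → <⇒≱ (s≤s q≤4) (+-cancelʳ-≤ (6 * p) _ _ (begin
          5 + 6 * p                                                        ≡⟨ regroup p ⟩
          (suc p + suc p) + ((suc p + suc p) + p + suc p)                  ≡⟨ cong₂ (λ u e → u + (u + p + e)) A∪B≡ ∣E∣≡ ⟨
          ∣ A ∪ B ∣ + (∣ A ∪ B ∣ + p + ∣ E ∣)                              ≤⟨ +-monoʳ-≤ (∣ A ∪ B ∣) (+-monoˡ-≤ (∣ E ∣) (+-monoʳ-≤ (∣ A ∪ B ∣) p≤)) ⟩
          ∣ A ∪ B ∣ + (∣ A ∪ B ∣ + ∣ E ─ (A ∪ B) ∣ + ∣ E ∣)                ≤⟨ +-monoʳ-≤ (∣ A ∪ B ∣) (three-unions A B E) ⟩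
          ∣ A ∪ B ∣ + (∣ B ∪ E ∣ + ∣ E ∪ A ∣)                              ≡⟨ +-assoc (∣ A ∪ B ∣) (∣ B ∪ E ∣) (∣ E ∪ A ∣) ⟨
          ∣ A ∪ B ∣ + ∣ B ∪ E ∣ + ∣ E ∪ A ∣                                ≤⟨ unions≤ QA QB QE ⟩
          6 * p + q                                                        ≡⟨ +-comm (6 * p) q ⟩
          q + 6 * p                                                        ∎))
          where open ≤-Reasoning

    upper₅ : q ≤ 5 → # Q? ≤ ∑C< n (suc p) + suc m C p + m C p
    upper₅ q≤5 with small-or-big
    ... | inj₁ small = ≤-trans (#≤-layer small) (≤-trans (+-monoʳ-≤ (∑C< n (suc p)) (#-no-3-matching (layer? (suc p)) (λ _ → proj₂) blocked))
                         (≤-reflexive (sym (+-assoc (∑C< n (suc p)) (suc m C p) (m C p)))))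
      where
      regroup : ∀ p → 6 + 6 * p ≡ (suc p + suc p) + (suc p + suc p) + (suc p + suc p)
      regroup = solve-∀
      -- Three pairwise disjoint (p + 1)-sets would have unions of total size 3(2p + 2) = 6p + 6.
      blocked : ∀ A B E → Q A × ∣ A ∣ ≡ suc p → Q B × ∣ B ∣ ≡ suc p → Q E × ∣ E ∣ ≡ suc p →
                Empty (A ∩ B) → Nonempty (E ∩ (A ∪ B))
      blocked A B E (QA , ∣A∣≡) (QB , ∣B∣≡) (QE , ∣E∣≡) ∅ = decidable-stable (nonempty? (E ∩ (A ∪ B))) λ ∅′ →
        let A∪B≡ = trans (disjoint-∣∪∣ A B ∅) (cong₂ _+_ ∣A∣≡ ∣B∣≡)
            B∪E≡ = trans (disjoint-∣∪∣ B E λ (x , x∈) → let x∈B , x∈E = x∈p∩q⁻ B E x∈ in ∅′ (x , x∈p∩q⁺ (x∈E , q⊆p∪q A B x∈B)))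
                         (cong₂ _+_ ∣B∣≡ ∣E∣≡)
            E∪A≡ = trans (disjoint-∣∪∣ E A λ (x , x∈) → let x∈E , x∈A = x∈p∩q⁻ E A x∈ in ∅′ (x , x∈p∩q⁺ (x∈E , p⊆p∪q B x∈A)))
                         (cong₂ _+_ ∣E∣≡ ∣A∣≡)
            bound = subst (_≤ 6 * p + q) (cong₂ _+_ (cong₂ _+_ A∪B≡ B∪E≡) E∪A≡) (unions≤ QA QB QE)
        in <⇒≱ (s≤s q≤5) (+-cancelʳ-≤ (6 * p) _ _ (≤-trans (≤-reflexive (regroup p)) (≤-trans bound (≤-reflexive (+-comm (6 * p) q)))))
    ... | inj₂ (A , QA , ∣A∣≡) = ≤-trans #≤ (≤-trans (+-monoʳ-≤ (∑C< n (suc p)) (+-monoˡ-≤ (m C p) #boundary))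
                                   (≤-reflexive (sym (+-assoc (∑C< n (suc p)) (suc m C p) (m C p)))))
      where
      open Big q≤5 A QA ∣A∣≡
      size : ∀ D → Q D × suc p ≤ ∣ D ∣ × ∣ D ─ A ∣ ≡ p → ∣ D ∣ ≡ suc p
      size D (QD , p<D , D─A≡) = ≤-antisym (+-cancelˡ-≤ 4 _ _ (≤-trans (boundary-size D QD D─A≡)
        (≤-trans (+-monoʳ-≤ p q≤5) (≤-reflexive (trans (+-comm p 5) (sym (+-suc 4 p))))))) p<D
      count : ∀ u i p q → (2 + p + p) + u + (2 + p + p) ≤ 6 * p + q → u + i ≡ suc p + suc p → 6 ≤ q + i
      count u i p q u≤ u+i = +-cancelˡ-≤ (6 * p) _ _ (begin
        6 * p + 6                                     ≡⟨ regroup₁ p ⟩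
        (2 + p + p) + (suc p + suc p) + (2 + p + p)   ≡⟨ cong (λ z → (2 + p + p) + z + (2 + p + p)) u+i ⟨
        (2 + p + p) + (u + i) + (2 + p + p)           ≡⟨ regroup₂ u i p ⟩
        (2 + p + p) + u + (2 + p + p) + i             ≤⟨ +-monoˡ-≤ i u≤ ⟩
        6 * p + q + i                                 ≡⟨ +-assoc (6 * p) q i ⟩
        6 * p + (q + i)                               ∎)
        where
        open ≤-Reasoning
        regroup₁ : ∀ p → 6 * p + 6 ≡ (2 + p + p) + (suc p + suc p) + (2 + p + p)
        regroup₁ = solve-∀
        regroup₂ : ∀ u i p → (2 + p + p) + (u + i) + (2 + p + p) ≡ (2 + p + p) + u + (2 + p + p) + i
        regroup₂ = solve-∀
      -- A ∪ D and E ∪ A have 2p + 2 elements each, which leaves |D ∪ E| ≤ 2p + q - 4 ≤ 2p + 1, too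
      -- little for disjoint (p + 1)-sets.
      meet : ∀ D E → Q D × suc p ≤ ∣ D ∣ × ∣ D ─ A ∣ ≡ p → Q E × suc p ≤ ∣ E ∣ × ∣ E ─ A ∣ ≡ p → 1 ≤ ∣ D ∩ E ∣
      meet D E KD@(QD , _ , D─A≡) KE@(QE , _ , E─A≡) = +-cancelˡ-≤ 5 _ _ (≤-trans
        (count (∣ D ∪ E ∣) (∣ D ∩ E ∣) p q
          (subst₂ (λ a b → a + ∣ D ∪ E ∣ + b ≤ 6 * p + q) (A∪≡ D D─A≡) (trans (cong ∣_∣ (∪-comm E A)) (A∪≡ E E─A≡)) (unions≤ QA QD QE))
          (layer-∩ D E (size D KD) (size E KE)))
        (+-monoˡ-≤ ∣ D ∩ E ∣ q≤5))
      #boundary : # boundary? ≤ suc m C p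
      #boundary = #-intersecting boundary? size meet

-- The function h

∁-involutive : ∀ {n} (A : Subset n) → ∁ (∁ A) ≡ A
∁-involutive []            = refl
∁-involutive (inside  ∷ A) = cong (inside ∷_) (∁-involutive A)
∁-involutive (outside ∷ A) = cong (outside ∷_) (∁-involutive A)

∁-injective : ∀ {n} {A B : Subset n} → ∁ A ≡ ∁ B → A ≡ B
∁-injective {A = A} {B} eq = trans (sym (∁-involutive A)) (trans (cong ∁ eq) (∁-involutive B))

#-∁ : ∀ {n} {P : Pred (Subset n) 0ℓ} (P? : Decidable P) → # (λ D → P? (∁ D)) ≡ # P?
#-∁ {zero}  P? = refl
#-∁ {suc n} P? = trans (cong₂ _+_ (#-∁ λ D → P? (outside ∷ D)) (#-∁ λ D → P? (inside ∷ D))) (+-comm _ (# λ D → P? (inside ∷ D)))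

∣∩∣+∣∁∪∁∣ : ∀ {n} (A B : Subset n) → ∣ A ∩ B ∣ + ∣ ∁ A ∪ ∁ B ∣ ≡ n
∣∩∣+∣∁∪∁∣ []            []            = refl
∣∩∣+∣∁∪∁∣ (inside  ∷ A) (inside  ∷ B) = cong suc (∣∩∣+∣∁∪∁∣ A B)
∣∩∣+∣∁∪∁∣ (inside  ∷ A) (outside ∷ B) = trans (+-suc _ _) (cong suc (∣∩∣+∣∁∪∁∣ A B))
∣∩∣+∣∁∪∁∣ (outside ∷ A) (inside  ∷ B) = trans (+-suc _ _) (cong suc (∣∩∣+∣∁∪∁∣ A B))
∣∩∣+∣∁∪∁∣ (outside ∷ A) (outside ∷ B) = trans (+-suc _ _) (cong suc (∣∩∣+∣∁∪∁∣ A B))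

d+unions : ∀ {n} (A B E : Subset n) → d A B E + unions (∁ A) (∁ B) (∁ E) ≡ 3 * n
d+unions {n} A B E = begin
  d A B E + unions (∁ A) (∁ B) (∁ E)                                      ≡⟨ regroup (∣ A ∩ B ∣) (∣ B ∩ E ∣) (∣ E ∩ A ∣) (∣ ∁ A ∪ ∁ B ∣) (∣ ∁ B ∪ ∁ E ∣) (∣ ∁ E ∪ ∁ A ∣) ⟩
  (∣ A ∩ B ∣ + ∣ ∁ A ∪ ∁ B ∣) + ((∣ B ∩ E ∣ + ∣ ∁ B ∪ ∁ E ∣) + ((∣ E ∩ A ∣ + ∣ ∁ E ∪ ∁ A ∣) + 0))
                                                                          ≡⟨ cong₂ _+_ (∣∩∣+∣∁∪∁∣ A B) (cong₂ _+_ (∣∩∣+∣∁∪∁∣ B E) (cong (_+ 0) (∣∩∣+∣∁∪∁∣ E A))) ⟩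
  3 * n                                                                   ∎
  where
  open ≡-Reasoning
  regroup : ∀ a b c x y z → a + b + c + (x + y + z) ≡ (a + x) + ((b + y) + ((c + z) + 0))
  regroup = solve-∀

#≤h : ∀ {n} x {P : Pred (Subset n) 0ℓ} (P? : Decidable P) →
      (∀ {A B E} → P A → P B → P E → unions A B E ≤ x) → # P? ≤ h n (3 * n ∸ x)
#≤h {n} x {P} P? bound = subst (_≤ h n (3 * n ∸ x)) (trans (length-map ∁ members) (length-filter-subsets P?))
  (h-upper n (3 * n ∸ x) (map ∁ members) (Unique.map⁺ ∁-injective (Unique.filter⁺ P? (subsets-unique n))) in-𝐇)
  where
  members = filter P? (subsets n)
  member : ∀ {A} → A ∈ₗ map ∁ members → P (∁ A)
  member A∈ with B , B∈ , refl ← ∈-map⁻ ∁ A∈ =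
    subst P (sym (∁-involutive B)) (proj₂ (∈-filter⁻ P? {xs = subsets n} B∈))
  in-𝐇 : 𝐇 (3 * n ∸ x) (map ∁ members)
  in-𝐇 {A} {B} {E} A∈ B∈ E∈ = begin
    3 * n ∸ x                                                                 ≤⟨ ∸-monoʳ-≤ (3 * n) (bound (member A∈) (member B∈) (member E∈)) ⟩
    3 * n ∸ unions (∁ A) (∁ B) (∁ E)                                          ≡⟨ cong (_∸ unions (∁ A) (∁ B) (∁ E)) (d+unions A B E) ⟨
    d A B E + unions (∁ A) (∁ B) (∁ E) ∸ unions (∁ A) (∁ B) (∁ E)             ≡⟨ m+n∸n≡m (d A B E) (unions (∁ A) (∁ B) (∁ E)) ⟩
    d A B E                                                                   ∎
    where open ≤-Reasoning

length≡# : ∀ {n} {ℱ : List (Subset n)} → Unique ℱ → length ℱ ≡ # (λ D → mem? (≡-dec _≟ᵇ_) D ℱ)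
length≡# {n} {ℱ} unique = trans
  (↭-length (∼bag⇒↭ (unique∧set⇒bag unique (Unique.filter⁺ ∈ℱ? (subsets-unique n))
    (mk⇔ (λ D∈ → ∈-filter⁺ ∈ℱ? (∈-subsets _) D∈) (λ D∈ → proj₂ (∈-filter⁻ ∈ℱ? {xs = subsets n} D∈))))))
  (length-filter-subsets ∈ℱ?)
  where
  ∈ℱ? : Decidable (_∈ₗ ℱ)
  ∈ℱ? D = mem? (≡-dec _≟ᵇ_) D ℱ

∪-mono-∣∣ : ∀ {n} {A A′ B B′ : Subset n} → A ⊆ A′ → B ⊆ B′ → ∣ A ∪ B ∣ ≤ ∣ A′ ∪ B′ ∣
∪-mono-∣∣ {A = A} {A′} {B} {B′} A⊆ B⊆ = p⊆q⇒∣p∣≤∣q∣ ⊆∪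
  where
  ⊆∪ : A ∪ B ⊆ A′ ∪ B′
  ⊆∪ x∈ with x∈p∪q⁻ A B x∈
  ... | inj₁ x∈A = p⊆p∪q B′ (A⊆ x∈A)
  ... | inj₂ x∈B = q⊆p∪q A′ B′ (B⊆ x∈B)

h≤ : ∀ n x X →
     (∀ {Q : Pred (Subset n) 0ℓ} (Q? : Decidable Q) → (∀ {D E} → D ⊆ E → Q E → Q D) →
       (∀ {A B E} → Q A → Q B → Q E → unions A B E ≤ x) → # Q? ≤ X) →
     h n (3 * n ∸ x) ≤ X
h≤ n x X bound with ℱ , unique , in-𝐇 , length≡h ← h-attained n (3 * n ∸ x) = begin
  h n (3 * n ∸ x)           ≡⟨ length≡h ⟨
  length ℱ                  ≡⟨ length≡# unique ⟩
  # ∈ℱ?                     ≡⟨ #-∁ ∈ℱ? ⟨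
  # (λ D → ∈ℱ? (∁ D))       ≤⟨ #-mono (λ D → ∈ℱ? (∁ D)) Q? (λ D ∁D∈ → lose ∁D∈ (⊆-reflexive (sym (∁-involutive D)))) ⟩
  # Q?                      ≤⟨ bound Q? Q-down Q-unions ⟩
  X                         ∎
  where
  open ≤-Reasoning
  ∈ℱ? : Decidable (_∈ₗ ℱ)
  ∈ℱ? D = mem? (≡-dec _≟ᵇ_) D ℱ
  Q : Pred (Subset n) 0ℓ
  Q D = Any (λ A → D ⊆ ∁ A) ℱ
  Q? : Decidable Q
  Q? D = Any.any? (λ A → D ⊆? ∁ A) ℱ
  Q-down : ∀ {D E} → D ⊆ E → Q E → Q D
  Q-down D⊆E QE with _ , A∈ , E⊆ ← find QE = lose A∈ λ x∈ → E⊆ (D⊆E x∈)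
  Q-unions : ∀ {A B E} → Q A → Q B → Q E → unions A B E ≤ x
  Q-unions {A} {B} {E} QA QB QE with A′ , A∈ , A⊆ ← find QA | B′ , B∈ , B⊆ ← find QB | E′ , E∈ , E⊆ ← find QE =
    +-cancelˡ-≤ (d A′ B′ E′) _ _ (begin
      d A′ B′ E′ + unions A B E                       ≤⟨ +-monoʳ-≤ (d A′ B′ E′) (+-mono-≤ (+-mono-≤ (∪-mono-∣∣ A⊆ B⊆) (∪-mono-∣∣ B⊆ E⊆)) (∪-mono-∣∣ E⊆ A⊆)) ⟩
      d A′ B′ E′ + unions (∁ A′) (∁ B′) (∁ E′)        ≡⟨ d+unions A′ B′ E′ ⟩
      -- Only an inequality, since `∸` truncates when x > 3n.
      3 * n                                           ≤⟨ m≤n+m∸n (3 * n) x ⟩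
      x + (3 * n ∸ x)                                 ≤⟨ +-monoʳ-≤ x (in-𝐇 A∈ B∈ E∈) ⟩
      x + d A′ B′ E′                                  ≡⟨ +-comm x (d A′ B′ E′) ⟩
      d A′ B′ E′ + x                                  ∎)

-- Extremal families

∣∪∣-sharing : ∀ {n} {A B : Subset n} S {a b} → S ⊆ A → S ⊆ B → ∣ A ∣ ≤ a → ∣ B ∣ ≤ b → ∣ A ∪ B ∣ + ∣ S ∣ ≤ a + b
∣∪∣-sharing {A = A} {B} S {a} {b} S⊆A S⊆B A≤ B≤ = begin
  ∣ A ∪ B ∣ + ∣ S ∣          ≤⟨ +-monoʳ-≤ (∣ A ∪ B ∣) (p⊆q⇒∣p∣≤∣q∣ λ x∈S → x∈p∩q⁺ (S⊆A x∈S , S⊆B x∈S)) ⟩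
  ∣ A ∪ B ∣ + ∣ A ∩ B ∣      ≡⟨ ∣∪∣+∣∩∣ A B ⟩
  ∣ A ∣ + ∣ B ∣              ≤⟨ +-mono-≤ A≤ B≤ ⟩
  a + b                      ∎
  where open ≤-Reasoning

#-between-≡ : ∀ {n} (S W : Subset n) {s w} j → S ⊆ W → ∣ S ∣ ≡ s → ∣ W ∣ ≡ w → # (between? S W (s + j)) ≡ (w ∸ s) C j
#-between-≡ S W j S⊆W refl refl = trans (#-between S W j S⊆W) (cong (_C j) (∣─∣≡∸ S W S⊆W))

-- Makes the condition on triples a finite check: `excess i j` is what a set of class i and one of
-- class j may add to 2p, and only triples of classes remain to be tested.
classes-unions : ∀ {n c} p q (P : Fin c → Pred (Subset n) 0ℓ) (excess : Fin c → Fin c → ℕ) →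
                 (∀ i j k → excess i j + excess j k + excess k i ≤ q) →
                 (∀ i j {A B} → P i A → P j B → ∣ A ∪ B ∣ ≤ 2 * p + excess i j) →
                 ∀ {A B E} → ∃[ i ] P i A → ∃[ j ] P j B → ∃[ k ] P k E → unions A B E ≤ 6 * p + q
classes-unions p q P e e≤ ∪≤ {A} {B} {E} (i , PA) (j , PB) (k , PE) = begin
  unions A B E                                                      ≤⟨ +-mono-≤ (+-mono-≤ (∪≤ i j PA PB) (∪≤ j k PB PE)) (∪≤ k i PE PA) ⟩
  (2 * p + e i j) + (2 * p + e j k) + (2 * p + e k i)               ≡⟨ regroup p (e i j) (e j k) (e k i) ⟩
  6 * p + (e i j + e j k + e k i)                                   ≤⟨ +-monoʳ-≤ (6 * p) (e≤ i j k) ⟩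
  6 * p + q                                                         ∎
  where
  open ≤-Reasoning
  regroup : ∀ p a b c → (2 * p + a) + (2 * p + b) + (2 * p + c) ≡ 6 * p + (a + b + c)
  regroup = solve-∀

module Extremal (m p : ℕ) where

  n : ℕ
  n = suc (suc m)

  Small : Pred (Subset n) 0ℓ
  Small D = ∣ D ∣ < suc p

  small? : Decidable Small
  small? D = ∣ D ∣ <? suc p

  small-small : ∀ {A B} → Small A → Small B → ∣ A ∪ B ∣ ≤ 2 * p + 0
  small-small {A} {B} A≤ B≤ = ≤-trans (∣∪∣≤ A B) (≤-trans (+-mono-≤ (s≤s⁻¹ A≤) (s≤s⁻¹ B≤)) (≤-reflexive (regroup p)))
    where
    regroup : ∀ p → p + p ≡ 2 * p + 0
    regroup = solve-∀

  small-big : ∀ {A B} → Small A → ∣ B ∣ ≡ suc p → ∣ A ∪ B ∣ ≤ 2 * p + 1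
  small-big {A} {B} A≤ B≡ = ≤-trans (∣∪∣≤ A B) (≤-trans (+-mono-≤ (s≤s⁻¹ A≤) (≤-reflexive B≡)) (≤-reflexive (regroup p)))
    where
    regroup : ∀ p → p + suc p ≡ 2 * p + 1
    regroup = solve-∀

  big-small : ∀ {A B} → ∣ A ∣ ≡ suc p → Small B → ∣ A ∪ B ∣ ≤ 2 * p + 1
  big-small {A} {B} A≡ B≤ = subst (_≤ 2 * p + 1) (cong ∣_∣ (∪-comm B A)) (small-big {B} {A} B≤ A≡)

  big-big : ∀ {A B} (S : Subset n) {s e} → ∣ S ∣ ≡ s → s + e ≡ 2 → S ⊆ A → S ⊆ B → ∣ A ∣ ≡ suc p → ∣ B ∣ ≡ suc p → ∣ A ∪ B ∣ ≤ 2 * p + e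
  big-big {A} {B} S {s} {e} refl s+e S⊆A S⊆B A≡ B≡ = +-cancelʳ-≤ s _ _ (begin
    ∣ A ∪ B ∣ + s       ≤⟨ ∣∪∣-sharing S S⊆A S⊆B (≤-reflexive A≡) (≤-reflexive B≡) ⟩
    suc p + suc p       ≡⟨ regroup p ⟩
    2 * p + 2           ≡⟨ cong (2 * p +_) (trans (sym s+e) (+-comm s e)) ⟩
    2 * p + (e + s)     ≡⟨ +-assoc (2 * p) e s ⟨
    2 * p + e + s       ∎)
    where
    open ≤-Reasoning
    regroup : ∀ p → suc p + suc p ≡ 2 * p + 2
    regroup = solve-∀

  small-unions : ∀ {A B E} → Small A → Small B → Small E → unions A B E ≤ 6 * p + 0
  small-unions {A} {B} {E} A≤ B≤ E≤ = classes-unions p 0 (λ (_ : Fin 1) → Small) (λ _ _ → 0) (λ _ _ _ → z≤n)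
    (λ _ _ {A} {B} → small-small {A} {B}) {A} {B} {E} (zero , A≤) (zero , B≤) (zero , E≤)

  lower₀ : ∀ q → ∑C< n (suc p) ≤ h n (3 * n ∸ (6 * p + q))
  lower₀ q = subst (_≤ h n (3 * n ∸ (6 * p + q))) (#-< n (suc p))
    (#≤h (6 * p + q) small? λ {A} {B} {E} A≤ B≤ E≤ → ≤-trans (small-unions {A} {B} {E} A≤ B≤ E≤) (+-monoʳ-≤ (6 * p) z≤n))

  #-small+ : ∀ {P R : Pred (Subset n) 0ℓ} (P? : Decidable P) (R? : Decidable R) → (∀ D → R D → ∣ D ∣ ≡ suc p) →
             (∀ D → Small D → P D) → (∀ D → R D → P D) → ∑C< n (suc p) + # R? ≤ # P?
  #-small+ P? R? big S⇒ R⇒ = subst (λ z → z + # R? ≤ # P?) (#-< n (suc p))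
    (#-superadditive P? small? R? S⇒ R⇒ λ D D< RD → <⇒≢ D< (big D RD))

  module _ (S : Subset n) where

    Star : Fin 2 → Pred (Subset n) 0ℓ
    Star zero       = Small
    Star (suc zero) = Between S ⊤ (suc p)

    star? : Decidable (λ D → ∃[ i ] Star i D)
    star? D = Fin.any? λ { zero → small? D ; (suc zero) → between? S ⊤ (suc p) D }

    -- Two (p + 1)-sets through S have excess e = 2 - |S|. A triple then totals at most 2 if |S| = 2
    -- and at most 3 if |S| = 1.
    excess₂ : ℕ → Fin 2 → Fin 2 → ℕ
    excess₂ e zero       zero       = 0
    excess₂ e zero       (suc zero) = 1
    excess₂ e (suc zero) zero       = 1
    excess₂ e (suc zero) (suc zero) = e

    star-∪ : ∀ e → ∣ S ∣ + e ≡ 2 → ∀ i j {A B} → Star i A → Star j B → ∣ A ∪ B ∣ ≤ 2 * p + excess₂ e i j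
    star-∪ e S+e zero       zero       {A} {B} A≤ B≤                         = small-small {A} {B} A≤ B≤
    star-∪ e S+e zero       (suc zero) {A} {B} A≤ (_ , _ , B≡)               = small-big {A} {B} A≤ B≡
    star-∪ e S+e (suc zero) zero       {A} {B} (_ , _ , A≡) B≤               = big-small {A} {B} A≡ B≤
    star-∪ e S+e (suc zero) (suc zero) {A} {B} (S⊆A , _ , A≡) (S⊆B , _ , B≡) = big-big {A} {B} S refl S+e S⊆A S⊆B A≡ B≡

    star≤h : ∀ e {q₀ q} → ∣ S ∣ + e ≡ 2 → (∀ i j k → excess₂ e i j + excess₂ e j k + excess₂ e k i ≤ q₀) → q₀ ≤ q →
            ∑C< n (suc p) + # (between? S ⊤ (suc p)) ≤ h n (3 * n ∸ (6 * p + q))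
    star≤h e {q₀} {q} S+e e≤ q₀≤q = ≤-trans
      (#-small+ star? (between? S ⊤ (suc p)) (λ _ (_ , _ , ≡p) → ≡p) (λ _ D< → zero , D<) (λ _ D∈ → suc zero , D∈))
      (#≤h (6 * p + q) star? λ A∈ B∈ E∈ → ≤-trans (classes-unions p q₀ Star (excess₂ e) e≤ (star-∪ e S+e) A∈ B∈ E∈) (+-monoʳ-≤ (6 * p) q₀≤q))

  lower₃ : ∀ {q} → 3 ≤ q → ∑C< n (suc p) + suc m C p ≤ h n (3 * n ∸ (6 * p + q))
  lower₃ {q} 3≤q = subst (λ z → ∑C< n (suc p) + z ≤ h n (3 * n ∸ (6 * p + q)))
    (#-between-≡ {n} ⁅ zero ⁆ ⊤ p ⊆⊤ (∣⁅x⁆∣≡1 {n} zero) (∣⊤∣≡n n))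
    (star≤h ⁅ zero ⁆ 1 (cong (_+ 1) (∣⁅x⁆∣≡1 {n} zero)) (from-yes (Fin.all? λ i → Fin.all? λ j → Fin.all? λ k →
       excess₂ ⁅ zero ⁆ 1 i j + excess₂ ⁅ zero ⁆ 1 j k + excess₂ ⁅ zero ⁆ 1 k i ≤? 3)) 3≤q)

  -- Classes 1 and 2 are the (p + 1)-sets meeting the pair of the first two points, split by the
  -- first point so that the classes are disjoint. Of three such sets two lie in the same class and
  -- share a point, so the excesses total at most 2 + 2 + 1 = 5.
  Cross : Fin 3 → Pred (Subset n) 0ℓ
  Cross zero             = Small
  Cross (suc zero)       = Between ⁅ zero ⁆ ⊤ (suc p)
  Cross (suc (suc zero)) = Between ⁅ suc zero ⁆ (∁ ⁅ zero ⁆) (suc p)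

  cross? : Decidable (λ D → ∃[ i ] Cross i D)
  cross? D = Fin.any? λ { zero             → small? D
                        ; (suc zero)       → between? ⁅ zero ⁆ ⊤ (suc p) D
                        ; (suc (suc zero)) → between? ⁅ suc zero ⁆ (∁ ⁅ zero ⁆) (suc p) D }

  excess₃ : Fin 3 → Fin 3 → ℕ
  excess₃ zero             zero             = 0
  excess₃ zero             (suc _)          = 1
  excess₃ (suc _)          zero             = 1
  excess₃ (suc zero)       (suc zero)       = 1
  excess₃ (suc zero)       (suc (suc zero)) = 2
  excess₃ (suc (suc zero)) (suc zero)       = 2
  excess₃ (suc (suc zero)) (suc (suc zero)) = 1

  cross-∪ : ∀ i j {A B} → Cross i A → Cross j B → ∣ A ∪ B ∣ ≤ 2 * p + excess₃ i j
  cross-∪ zero             zero             {A} {B} A≤ B≤ = small-small {A} {B} A≤ B≤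
  cross-∪ zero             (suc zero)       {A} {B} A≤ (_ , _ , B≡) = small-big {A} {B} A≤ B≡
  cross-∪ zero             (suc (suc zero)) {A} {B} A≤ (_ , _ , B≡) = small-big {A} {B} A≤ B≡
  cross-∪ (suc zero)       zero             {A} {B} (_ , _ , A≡) B≤ = big-small {A} {B} A≡ B≤
  cross-∪ (suc (suc zero)) zero             {A} {B} (_ , _ , A≡) B≤ = big-small {A} {B} A≡ B≤
  cross-∪ (suc zero)       (suc zero)       {A} {B} (S⊆A , _ , A≡) (S⊆B , _ , B≡) =
    big-big {A} {B} ⁅ zero ⁆ (∣⁅x⁆∣≡1 {n} zero) refl S⊆A S⊆B A≡ B≡
  cross-∪ (suc zero)       (suc (suc zero)) {A} {B} (_ , _ , A≡) (_ , _ , B≡) =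
    big-big {A} {B} ⊥ (∣⊥∣≡0 n) refl ⊥⊆ ⊥⊆ A≡ B≡
  cross-∪ (suc (suc zero)) (suc zero)       {A} {B} (_ , _ , A≡) (_ , _ , B≡) =
    big-big {A} {B} ⊥ (∣⊥∣≡0 n) refl ⊥⊆ ⊥⊆ A≡ B≡
  cross-∪ (suc (suc zero)) (suc (suc zero)) {A} {B} (S⊆A , _ , A≡) (S⊆B , _ , B≡) =
    big-big {A} {B} ⁅ suc zero ⁆ (∣⁅x⁆∣≡1 {n} (suc zero)) refl S⊆A S⊆B A≡ B≡

  lower₅ : ∑C< n (suc p) + suc m C p + m C p ≤ h n (3 * n ∸ (6 * p + 5))
  lower₅ = begin
    ∑C< n (suc p) + suc m C p + m C p                ≡⟨ cong₂ (λ a b → ∑C< n (suc p) + a + b) #one #two ⟨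
    ∑C< n (suc p) + # one? + # two?                 ≡⟨ +-assoc (∑C< n (suc p)) (# one?) (# two?) ⟩
    ∑C< n (suc p) + (# one? + # two?)               ≤⟨ +-monoʳ-≤ (∑C< n (suc p)) (#-superadditive big? one? two? (λ _ → inj₁) (λ _ → inj₂) disjoint) ⟩
    ∑C< n (suc p) + # big?                           ≤⟨ #-small+ cross? big? big-size (λ _ D< → zero , D<) (λ { _ (inj₁ D∈) → suc zero , D∈ ; _ (inj₂ D∈) → suc (suc zero) , D∈ }) ⟩
    # cross?                                         ≤⟨ #≤h (6 * p + 5) cross? (classes-unions p 5 Cross excess₃ excess₃≤5 cross-∪) ⟩
    h n (3 * n ∸ (6 * p + 5))                        ∎
    where
    open ≤-Reasoning
    one? = between? {n} ⁅ zero ⁆ ⊤ (suc p)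
    two? = between? {n} ⁅ suc zero ⁆ (∁ ⁅ zero ⁆) (suc p)
    big? : Decidable (λ D → Cross (suc zero) D ⊎ Cross (suc (suc zero)) D)
    big? D = one? D ⊎-dec two? D
    big-size : ∀ D → Cross (suc zero) D ⊎ Cross (suc (suc zero)) D → ∣ D ∣ ≡ suc p
    big-size D (inj₁ (_ , _ , ≡p)) = ≡p
    big-size D (inj₂ (_ , _ , ≡p)) = ≡p
    disjoint : ∀ D → Cross (suc zero) D → ¬ Cross (suc (suc zero)) D
    disjoint D (0⊆D , _) (_ , D⊆ , _) = x∈∁p⇒x∉p (D⊆ (0⊆D here)) here
    excess₃≤5 : ∀ i j k → excess₃ i j + excess₃ j k + excess₃ k i ≤ 5
    excess₃≤5 = from-yes (Fin.all? λ i → Fin.all? λ j → Fin.all? λ k → excess₃ i j + excess₃ j k + excess₃ k i ≤? 5)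
    #one : # one? ≡ suc m C p
    #one = #-between-≡ {n} ⁅ zero ⁆ ⊤ p ⊆⊤ (∣⁅x⁆∣≡1 {n} zero) (∣⊤∣≡n n)
    #two : # two? ≡ m C p
    #two = #-between-≡ {n} ⁅ suc zero ⁆ (∁ ⁅ zero ⁆) p
      (λ x∈1 → x∉p⇒x∈∁p λ x∈0 → case trans (sym (x∈⁅y⁆⇒x≡y (suc zero) x∈1)) (x∈⁅y⁆⇒x≡y zero x∈0) of λ ())
      (∣⁅x⁆∣≡1 {n} (suc zero)) (trans (∣∁p∣≡n∸∣p∣ {n} ⁅ zero ⁆) (cong (n ∸_) (∣⁅x⁆∣≡1 {n} zero)))

lower₂ : ∀ m r → ∑C< (suc (suc m)) (2 + r) + m C r ≤ h (suc (suc m)) (3 * suc (suc m) ∸ (6 * suc r + 2))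
lower₂ m r = subst (λ z → ∑C< n (2 + r) + z ≤ h n (3 * n ∸ (6 * suc r + 2)))
  (#-between-≡ S ⊤ r ⊆⊤ ∣S∣≡2 (∣⊤∣≡n n))
  (star≤h S 0 (trans (+-identityʳ _) ∣S∣≡2) (from-yes (Fin.all? λ i → Fin.all? λ j → Fin.all? λ k →
     excess₂ S 0 i j + excess₂ S 0 j k + excess₂ S 0 k i ≤? 2)) ≤-refl)
  where
  open Extremal m (suc r)
  S : Subset n
  S = inside ∷ inside ∷ ⊥
  ∣S∣≡2 : ∣ S ∣ ≡ 2
  ∣S∣≡2 = cong (2 +_) (∣⊥∣≡0 m)

theorem2p6 : (p q n x : ℕ) → 1 ≤ p → q ≤ 5 → 2 ^ (3 * p + 2) * p ^ 2 + p + 1 ≤ n → x ≡ 6 * p + q →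
    ((q ≡ 0 ⊎ q ≡ 1) → h n (3 * n ∸ x) ≡ ∑C n p) ×
    (q ≡ 2 → h n (3 * n ∸ x) ≡ ∑C n p + (n ∸ 2) C (p ∸ 1)) ×
    ((q ≡ 3 ⊎ q ≡ 4) → h n (3 * n ∸ x) ≡ ∑C n p + (n ∸ 1) C p) ×
    (q ≡ 5 → h n (3 * n ∸ x) ≡ ∑C n p + (n ∸ 1) C p + (n ∸ 2) C p)
-- As p ≥ 1, the lower bound on n rules out n = 0 and n = 1.
theorem2p6 (suc r) q zero       x _ _ n≥ _ with () ← ≤-trans (m≤n+m 1 _) n≥
theorem2p6 (suc r) q (suc zero) x _ _ n≥ _ with s≤s () ← ≤-trans (+-mono-≤ {1} (≤-trans (s≤s z≤n) (m≤n+m (suc r) _)) (≤-refl {1})) n≥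
theorem2p6 (suc r) q (suc (suc m)) x _ _ n≥ refl =
    (λ { (inj₁ refl) → exact id mCp≤∑ (λ Q? down u l → Downset.upper₁ Q? down 0 u l z≤n) (lower₀ 0)
       ; (inj₂ refl) → exact id mCp≤∑ (λ Q? down u l → Downset.upper₁ Q? down 1 u l ≤-refl) (lower₀ 1) })
  , (λ { refl → exact (_+ m C r) (m≤n⇒m≤n+o _ mCp≤∑) (λ Q? down u l → Downset.upper₂ Q? down 2 u l ≤-refl) (lower₂ m r) })
  , (λ { (inj₁ refl) → exact (_+ suc m C p) (m≤n⇒m≤n+o _ mCp≤∑) (λ Q? down u l → Downset.upper₄ Q? down 3 u l (n≤1+n 3)) (lower₃ ≤-refl)
       ; (inj₂ refl) → exact (_+ suc m C p) (m≤n⇒m≤n+o _ mCp≤∑) (λ Q? down u l → Downset.upper₄ Q? down 4 u l ≤-refl) (lower₃ (n≤1+n 3)) })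
  , (λ { refl → exact (λ s → s + suc m C p + m C p) (m≤n⇒m≤n+o _ (m≤n⇒m≤n+o _ mCp≤∑)) (λ Q? down u l → Downset.upper₅ Q? down 5 u l ≤-refl) lower₅ })
  where
  p = suc r
  n = suc (suc m)
  c = 2 ^ (3 * p + 2)

  -- The hypothesis on n says c p² + p ≤ n - 1 = m + 1, the form that `∑C<-small` asks for.
  room : c * (p * p) + p ≤ suc m
  room = s≤s⁻¹ (≤-trans (≤-reflexive (trans (+-comm 1 _) (cong (λ z → c * (p * z) + p + 1) (sym (*-identityʳ p))))) n≥)

  sparse : c * ∑C< m p ≤ m C p
  sparse = ∑C<-small c m p (m^n>0 2 (3 * p + 2)) room

  sparse′ : c * ∑C< m r ≤ m C r
  sparse′ = ∑C<-small c m r (m^n>0 2 (3 * p + 2))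
    (≤-trans (+-mono-≤ (*-monoʳ-≤ c (*-mono-≤ (n≤1+n r) (n≤1+n r))) (n≤1+n r)) room)

  open LargeGroundSet r m sparse sparse′ using (mCp≤; module Downset)
  open Extremal m p using (lower₀; lower₃; lower₅)

  mCp≤∑ : m C p ≤ ∑C< n (suc p)
  mCp≤∑ = ≤-trans mCp≤ (≤-trans (C-monoˡ (suc m) p) (m≤n+m _ _))

  exact : ∀ {q} (f : ℕ → ℕ) (let X = f (∑C< n (suc p))) → m C p ≤ X →
          (∀ {Q : Pred (Subset n) 0ℓ} (Q? : Decidable Q) → (∀ {D E} → D ⊆ E → Q E → Q D) →
            (∀ {A B E} → Q A → Q B → Q E → unions A B E ≤ 6 * p + q) → m C p < # Q? → # Q? ≤ X) →
          X ≤ h n (3 * n ∸ (6 * p + q)) → h n (3 * n ∸ (6 * p + q)) ≡ f (∑C n p)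
  exact {q} f mCp≤X upper lower = trans (≤-antisym (h≤ n (6 * p + q) _ bound) lower) (cong f (sym (∑C≡∑C< n p)))
    where
    bound : ∀ {Q : Pred (Subset n) 0ℓ} (Q? : Decidable Q) → (∀ {D E} → D ⊆ E → Q E → Q D) →
            (∀ {A B E} → Q A → Q B → Q E → unions A B E ≤ 6 * p + q) → # Q? ≤ f (∑C< n (suc p))
    -- Families too small for `escape` satisfy every claimed bound, as C(n - 2, p) ≤ C(n, p).
    bound Q? down u with m C p <? # Q?
    ... | yes large  = upper Q? down u large
    ... | no  ¬large = ≤-trans (≮⇒≥ ¬large) mCp≤X
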